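{- For all compositions $\alpha,\beta$, $$G_{P_\alpha}(\bm x;q)G_{P_\beta}(\bm x;q)=\frac1qG_{P_{\alpha\cdot\beta}}(\bm x;q)+\frac{q-1}{q}G_{P_{\alpha\odot\beta}}(\bm x;q).$$ Consequently, for every composition $\alpha=\alpha_1\cdots\alpha_\ell$, $$h_{\lambda(\alpha)}(\bm x)=G_{P_{\alpha_1}}(\bm x;q)\cdots G_{P_{\alpha_\ell}}(\bm x;q)=\sum_{\beta}\frac{(q-1)^{\ell(\alpha)-\ell(\beta)}}{q^{\ell(\alpha)-1}}G_{P_\beta}(\bm x;q),$$ $$G_{P_\alpha}(\bm x;q)=\sum_{\beta}q^{\ell(\beta)-1}(q-1)^{\ell(\alpha)-\ell(\beta)}h_{\lambda(\beta)}(\bm x)=\sum_{\lambda\in\mathcal M(\alpha)}q^{\ell(\lambda)-1}(q-1)^{\ell(\alpha)-\ell(\lambda)}h_\lambda(\bm x),$$ where the sums over $\beta$ run over all coarsenings $\beta$ of $\alpha$ (including $\alpha$ itself). In particular, for compositions $\alpha,\beta$ we have $G_{P_\alpha}(\bm x;q)=G_{P_\beta}(\bm x;q)$ if and only if $\mathcal M(\alpha)=\mathcal M(\beta)$.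
   Context: A composition $\alpha=\alpha_1\cdots\alpha_n$ is a finite sequence of positive integers; $\ell(\alpha)=n$ is its length, $\lambda(\alpha)$ the partition obtained by sorting its parts decreasingly. Concatenation: $\alpha\cdot\beta=\alpha_1\cdots\alpha_n\beta_1\cdots\beta_m$; near-concatenation: $\alpha\odot\beta=\alpha_1\cdots\alpha_{n-1}(\alpha_n+\beta_1)\beta_2\cdots\beta_m$. A coarsening of $\alpha$ is a composition obtained from $\alpha$ by summing (possibly no) groups of adjacent parts. $\mathcal M(\alpha)$ is the multiset $\{\lambda(\beta):\beta\text{ a coarsening of }\alpha\}$. $h_k$ is the complete homogeneous symmetric function and $h_\lambda=h_{\lambda_1}h_{\lambda_2}\cdots$. Rows and LLT polynomials: a row is $R=a/b=\{(1,j):b+1\le j\le a\}$ ($a\ge b\ge0$), the content of $(1,j)$ being $j-1$. A horizontal-strip is a sequence of rows $(R_1,\dots,R_n)$; its LLT polynomial is $G_{\bm\lambda}(\bm x;q)=\sum_{\bm T}q^{\mathrm{inv}(\bm T)}\bm x^{\bm T}$, summed over tuples $\bm T=(T^{(1)},\dots,T^{(n)})$ of left-to-right weakly increasing fillings $T^{(i)}:R_i\to\{1,2,\dots\}$, where $\bm x^{\bm T}=\prod_k x_k^{\#\{\text{entries }=k\}}$ and $\mathrm{inv}(\bm T)$ counts pairs of entries $T^{(i)}(u),T^{(j)}(v)$ with $i<j$ such that either $c(u)=c(v)$ and $T^{(i)}(u)>T^{(j)}(v)$, or $c(u)=c(v)+1$ and $T^{(i)}(u)<T^{(j)}(v)$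 ($c$ = content). For a composition $\alpha=\alpha_1\cdots\alpha_n$, $P_\alpha$ is the weighted path with vertices $v_1,\dots,v_n$, $v_i$ of weight $\alpha_i$, and edges $(v_i,v_{i+1})$ of weight $1$. Its LLT polynomial is $G_{P_\alpha}(\bm x;q):=G_{\bm\lambda_\alpha}(\bm x;q)$ where $\bm\lambda_\alpha=(R_1,\dots,R_n)$, $R_i=(\sum_{j=1}^{n-i+1}\alpha_j)/(\sum_{j=1}^{n-i}\alpha_j)$ (a horizontal-strip whose associated weighted graph, with vertex weights $|R_i|$ and edge weights $M(R_i,R_j)$ for $i<j$, is isomorphic to $P_\alpha$; $G$ depends only on this weighted graph up to isomorphism).
   Formalization: In both forms of the third display, (q−1) is replaced by (1−q): as printed it fails for α = 11 (the coefficient of x₁² is 1, not 2q−1). Identities in q are stated for all rational values of q (nonzero where 1/q occurs), and compositions are nonempty. -}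

module Defs where

open import Data.Nat as ℕ using (ℕ; zero; suc; _∸_; _<ᵇ_; _≡ᵇ_)
open import Data.Bool using (Bool; true; false; if_then_else_; _∧_)
open import Data.List using (List; []; _∷_; map; concatMap; length; upTo; zip; zipWith; reverse; foldr; foldl)
open import Data.List.Relation.Unary.All using (All)
open import Data.Product using (_×_; _,_; proj₁; proj₂)
open import Data.Rational using (ℚ; 0ℚ; 1ℚ; _+_; _*_; _-_; 1/_; ≢-nonZero)
open import Relation.Binary.PropositionalEquality using (_≡_; _≢_)
open import Data.List.Relation.Binary.Permutation.Propositional using (_↭_)

IsComposition : List ℕ → Set
IsComposition α = (0 ℕ.< length α) × All (0 ℕ.<_) α

_·_ : List ℕ → List ℕ → List ℕ
[] · β = β
(a ∷ α) · β = a ∷ (α · β)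

_⊙_ : List ℕ → List ℕ → List ℕ
[] ⊙ β = β
(a ∷ []) ⊙ [] = a ∷ []
(a ∷ []) ⊙ (b ∷ β) = (a ℕ.+ b) ∷ β
(a ∷ a' ∷ α) ⊙ β = a ∷ ((a' ∷ α) ⊙ β)

addHead : ℕ → List ℕ → List ℕ
addHead a [] = a ∷ []
addHead a (b ∷ γ) = (a ℕ.+ b) ∷ γ

coarsenings : List ℕ → List (List ℕ)
coarsenings [] = [] ∷ []
coarsenings (a ∷ []) = (a ∷ []) ∷ []
coarsenings (a ∷ b ∷ rest) =
  concatMap (λ γ → (a ∷ γ) ∷ addHead a γ ∷ []) (coarsenings (b ∷ rest))

insertDec : ℕ → List ℕ → List ℕ
insertDec x [] = x ∷ []
insertDec x (y ∷ ys) = if y ℕ.<ᵇ x then x ∷ y ∷ ys else y ∷ insertDec x ys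

partitionOf : List ℕ → List ℕ
partitionOf = foldr insertDec []

-- the multiset 𝓜(α), as a list (multiset equality = permutation _↭_)
𝓜 : List ℕ → List (List ℕ)
𝓜 α = map partitionOf (coarsenings α)

-- Formal power series in x₁, x₂, … with coefficients in ℚ.
-- Such a series is given by its coefficient function: a list
-- μ = μ₁ ⋯ μ_N stands for the monomial x₁^μ₁ ⋯ x_N^μ_N (all further
-- variables to the power 0).  Polynomials in q are handled by
-- evaluating q at a rational number.

Series : Set
Series = List ℕ → ℚ

_≈ₛ_ : Series → Series → Set
F ≈ₛ G = ∀ μ → F μ ≡ G μ

sumℚ : List ℚ → ℚ
sumℚ = foldr _+_ 0ℚ

_^ℚ_ : ℚ → ℕ → ℚ
x ^ℚ zero = 1ℚ
x ^ℚ suc n = x * (x ^ℚ n)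

_⊕_ : Series → Series → Series
(F ⊕ G) μ = F μ + G μ

zeroS : Series
zeroS μ = 0ℚ

_⋆_ : ℚ → Series → Series
(c ⋆ F) μ = c * F μ

sumS : List Series → Series
sumS = foldr _⊕_ zeroS

below : List ℕ → List (List ℕ)
below [] = [] ∷ []
below (m ∷ μ) = concatMap (λ k → map (k ∷_) (below μ)) (upTo (suc m))

_⊛_ : Series → Series → Series
(F ⊛ G) μ = sumℚ (map (λ ν → F ν * G (zipWith _∸_ μ ν)) (below μ))

allZero : List ℕ → Bool
allZero [] = true
allZero (m ∷ μ) = (m ≡ᵇ 0) ∧ allZero μ

oneS : Series
oneS μ = if allZero μ then 1ℚ else 0ℚ

prodS : List Series → Series
prodS = foldr _⊛_ oneS

sumℕ : List ℕ → ℕ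
sumℕ = foldr ℕ._+_ 0

h : ℕ → Series
h k μ = if sumℕ μ ≡ᵇ k then 1ℚ else 0ℚ

hPart : List ℕ → Series
hPart λ' = prodS (map h λ')

-- a row a/b is represented by the pair (a , b); its cells have
-- contents b, b+1, …, a-1
Row : Set
Row = ℕ × ℕ

-- a filled cell: (content , entry)
FilledRow : Set
FilledRow = List (ℕ × ℕ)

weakIncr : ℕ → ℕ → ℕ → List (List ℕ)
weakIncr zero lo N = [] ∷ []
weakIncr (suc m) lo N =
  concatMap (λ e → map (e ∷_) (weakIncr m e N))
            (map (lo ℕ.+_) (upTo (suc N ∸ lo)))

fillings : ℕ → Row → List FilledRow
fillings N (a , b) = map (zip (map (b ℕ.+_) (upTo (a ∸ b)))) (weakIncr (a ∸ b) 1 N)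

tuples : ℕ → List Row → List (List FilledRow)
tuples N [] = [] ∷ []
tuples N (r ∷ rs) = concatMap (λ T → map (T ∷_) (tuples N rs)) (fillings N r)

-- the pair (u,v) with u in an earlier row than v is an inversion
invCell : ℕ × ℕ → ℕ × ℕ → ℕ
invCell (c , e) (c' , e') =
  (if (c ≡ᵇ c') ∧ (e' ℕ.<ᵇ e) then 1 else 0) ℕ.+
  (if (c ≡ᵇ suc c') ∧ (e ℕ.<ᵇ e') then 1 else 0)

cross : FilledRow → FilledRow → ℕ
cross T T' = sumℕ (map (λ u → sumℕ (map (invCell u) T')) T)

inv : List FilledRow → ℕ
inv [] = 0
inv (T ∷ Ts) = sumℕ (map (cross T) Ts) ℕ.+ inv Ts

count : ℕ → List ℕ → ℕ
count k [] = 0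
count k (x ∷ xs) = (if x ≡ᵇ k then 1 else 0) ℕ.+ count k xs

contentVec : ℕ → List FilledRow → List ℕ
contentVec N Ts = map (λ i → count (suc i) (concatMap (map proj₂) Ts)) (upTo N)

eqList : List ℕ → List ℕ → Bool
eqList [] [] = true
eqList [] (_ ∷ _) = false
eqList (_ ∷ _) [] = false
eqList (x ∷ xs) (y ∷ ys) = (x ≡ᵇ y) ∧ eqList xs ys

LLT : ℚ → List Row → Series
LLT q rows μ =
  sumℚ (map (λ T → if eqList (contentVec (length μ) T) μ then q ^ℚ inv T else 0ℚ)
            (tuples (length μ) rows))

-- partial sums S₀, S₁, …: rows of P_α are R_i = S_{n-i+1} / S_{n-i}
rowsFrom : ℕ → List ℕ → List Row
rowsFrom s [] = []
rowsFrom s (a ∷ α) = (s ℕ.+ a , s) ∷ rowsFrom (s ℕ.+ a) α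

pathRows : List ℕ → List Row
pathRows α = reverse (rowsFrom 0 α)

GP : ℚ → List ℕ → Series
GP q α = LLT q (pathRows α)

invℚ : (q : ℚ) → q ≢ 0ℚ → ℚ
invℚ q q≢0 = (1/ q) {{≢-nonZero q≢0}}

{-# OPTIONS --safe #-}

-- Read in the order of contents, a filling of the rows of P_α is a word cut into weakly increasing blocks of
-- lengths α₁, α₂, …, and inv counts the descents at the cuts.  For a product GP α ⊛ GP β the cut between α and β
-- is free: words without a descent there are those of α ⊙ β, words with a descent there cost an additional
-- factor q in α · β, which is the product rule.  The expansions follow by splitting off the first part.
--
-- For the last equivalence, q = 1 gives hPart α and q = ½ gives a multiple of the sum of hPart over the
-- coarsenings, so the claim is the linear independence of the products of complete homogeneous functions.
-- Since hPart λ μ = hPart μ λ, a relation between them says that two sums of point evaluations agree on all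
-- hPart μ.  By Newton's identities they agree on the power sum products pPart γ, and pPart γ vanishes at every
-- composition with at least as many parts as γ except the rearrangements of γ.
module Submission where

open import Defs
open import Data.Nat using (ℕ; _∸_)
open import Data.List using (List; []; _∷_; map; length)
open import Data.Product using (_×_)
open import Data.Rational using (ℚ; 0ℚ; 1ℚ; _*_; _-_)
open import Relation.Binary.PropositionalEquality using (_≢_)
open import Data.List.Relation.Binary.Permutation.Propositional using (_↭_)
open import Function.Bundles using (_⇔_)

open import Data.Nat as ℕ using (zero; suc; _≤_; _<_; z≤n; s≤s; _≡ᵇ_; _<ᵇ_)
import Data.Nat.Properties as ℕ
open import Data.Bool using (Bool; true; false; if_then_else_)
open import Data.Empty using (⊥-elim)
open import Data.List using (_++_; concatMap; upTo; applyUpTo; zipWith; zip; reverse; foldl)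
open import Data.List.Properties using (map-cong; map-∘; map-applyUpTo; map-concatMap; concatMap-cong; ++-identityʳ; unfold-reverse; reverse-++; length-reverse; ∷-injectiveˡ)
open import Data.List.Membership.Propositional using (_∈_; find; lose)
open import Data.List.Membership.Propositional.Properties using (∈-concatMap⁺; ∈-∃++; ∈-map⁺)
open import Data.List.Relation.Unary.All as All using (All; []; _∷_)
import Data.List.Relation.Unary.All.Properties as All
open import Data.List.Relation.Unary.Any as Any using (Any; here; there)
open import Data.List.Relation.Binary.Permutation.Propositional as ↭ using (↭-sym; prep; swap)
open import Data.List.Relation.Binary.Permutation.Propositional.Properties using (All-resp-↭; ∈-resp-↭; ↭-reverse; ↭-singleton-inv; ↭-length; shift; map⁺)
open import Data.Product using (_,_; proj₁; proj₂; ∃; ∃₂; map₁; uncurry)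
open import Data.Sum using (_⊎_; inj₁; inj₂)
open import Data.Rational as ℚ using (_+_; ≢-nonZero)
open import Data.Rational.Properties
open import Data.Rational.Solver using (module +-*-Solver)
open import Algebra.Properties.Group +-0-group using (∙-cancelˡ)
open import Function using (_∘_; flip)
open import Function.Bundles using (mk⇔)
open import Relation.Binary.Definitions using (tri<; tri≈; tri>)
open import Relation.Binary.PropositionalEquality hiding (_≢_)
open import Relation.Nullary using (yes; no)

open ≡-Reasoning
open +-*-Solver using (solve; _:+_; _:*_; _:=_; _:-_; con)

-- Finite sums and the ring of series

-- The rows of a path stand in reverse order: the first row has the largest contents, and prepending
-- a row to the tuple appends a part to the composition. The combinatorics is therefore done with
-- `Ĝ` on reversed compositions, and reversal exchanges the two factors of a product. The product
-- rule is kept multiplied by q until the end, so that the expansion into complete homogeneous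
-- functions holds for every rational q, including 0. Linear independence cannot be read off `hPart`
-- itself: its coefficient at μ counts matrices of natural numbers with given row and column sums,
-- which is positive as soon as the totals agree, so there is no triangularity. A term of a power
-- sum changes a single exponent, which is why products of power sums have small support. Power sums
-- are never expanded in the `h`; the property `Balanced` is instead shown to survive multiplication
-- by a power sum, which needs neither division nor signs. The value ½ is the solution of q = 1 - q,
-- where the two kinds of factors in the coefficients coincide; what is left depends only on the
-- length of α, and the value q = 1 determines that length.

∑ : {A : Set} → List A → (A → ℚ) → ℚ
∑ xs f = sumℚ (map f xs)

∑-cong : {A : Set} (xs : List A) {f g : A → ℚ} → (∀ x → f x ≡ g x) → ∑ xs f ≡ ∑ xs g
∑-cong xs f≗g = cong sumℚ (map-cong f≗g xs)

∑-congᴬ : {A : Set} {xs : List A} {f g : A → ℚ} → All (λ x → f x ≡ g x) xs → ∑ xs f ≡ ∑ xs g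
∑-congᴬ []       = refl
∑-congᴬ (e ∷ es) = cong₂ _+_ e (∑-congᴬ es)

∑-map : {A B : Set} (k : A → B) (xs : List A) (f : B → ℚ) → ∑ (map k xs) f ≡ ∑ xs (f ∘ k)
∑-map k xs f = cong sumℚ (sym (map-∘ xs))

∑-++ : {A : Set} (xs ys : List A) (f : A → ℚ) → ∑ (xs ++ ys) f ≡ ∑ xs f + ∑ ys f
∑-++ []       ys f = sym (+-identityˡ _)
∑-++ (x ∷ xs) ys f = trans (cong (f x +_) (∑-++ xs ys f)) (sym (+-assoc (f x) _ _))

∑-concatMap : {A B : Set} (k : A → List B) (xs : List A) (f : B → ℚ) →
              ∑ (concatMap k xs) f ≡ ∑ xs (λ x → ∑ (k x) f)
∑-concatMap k []       f = refl
∑-concatMap k (x ∷ xs) f =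
  trans (∑-++ (k x) (concatMap k xs) f) (cong (∑ (k x) f +_) (∑-concatMap k xs f))

∑-zero : {A : Set} (xs : List A) → ∑ xs (λ _ → 0ℚ) ≡ 0ℚ
∑-zero []       = refl
∑-zero (x ∷ xs) = trans (+-identityˡ _) (∑-zero xs)

∑-+ : {A : Set} (xs : List A) (f g : A → ℚ) → ∑ xs (λ x → f x + g x) ≡ ∑ xs f + ∑ xs g
∑-+ []       f g = refl
∑-+ (x ∷ xs) f g = trans (cong (f x + g x +_) (∑-+ xs f g))
  (solve 4 (λ a b c d → (a :+ b) :+ (c :+ d) := (a :+ c) :+ (b :+ d)) refl (f x) (g x) (∑ xs f) (∑ xs g))

∑-*ˡ : {A : Set} (xs : List A) (c : ℚ) (f : A → ℚ) → ∑ xs (λ x → c * f x) ≡ c * ∑ xs f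
∑-*ˡ []       c f = sym (*-zeroʳ c)
∑-*ˡ (x ∷ xs) c f = trans (cong (c * f x +_) (∑-*ˡ xs c f)) (sym (*-distribˡ-+ c _ _))

∑-*ʳ : {A : Set} (xs : List A) (c : ℚ) (f : A → ℚ) → ∑ xs (λ x → f x * c) ≡ ∑ xs f * c
∑-*ʳ xs c f = trans (∑-cong xs λ x → *-comm (f x) c) (trans (∑-*ˡ xs c f) (*-comm c _))

∑-swap : {A B : Set} (xs : List A) (ys : List B) (f : A → B → ℚ) →
         ∑ xs (λ x → ∑ ys (f x)) ≡ ∑ ys (λ y → ∑ xs (λ x → f x y))
∑-swap []       ys f = sym (∑-zero ys)
∑-swap (x ∷ xs) ys f = trans (cong (∑ ys (f x) +_) (∑-swap xs ys f)) (sym (∑-+ ys _ _))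

-- Convolution sums

antidiagonal : ℕ → List (ℕ × ℕ)
antidiagonal zero    = (0 , 0) ∷ []
antidiagonal (suc m) = (0 , suc m) ∷ map (map₁ suc) (antidiagonal m)

conv : (ℕ → ℕ → ℚ) → ℕ → ℚ
conv f m = ∑ (antidiagonal m) (uncurry f)

conv-suc : (f : ℕ → ℕ → ℚ) (m : ℕ) → conv f (suc m) ≡ f 0 (suc m) + conv (f ∘ suc) m
conv-suc f m = cong (f 0 (suc m) +_) (∑-map (map₁ suc) (antidiagonal m) (uncurry f))

conv-cong : {f g : ℕ → ℕ → ℚ} (m : ℕ) → (∀ i j → f i j ≡ g i j) → conv f m ≡ conv g m
conv-cong m e = ∑-cong (antidiagonal m) λ (i , j) → e i j

conv-+ : (m : ℕ) (f g : ℕ → ℕ → ℚ) → conv (λ i j → f i j + g i j) m ≡ conv f m + conv g m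
conv-+ m f g = ∑-+ (antidiagonal m) (uncurry f) (uncurry g)

conv-snoc : (f : ℕ → ℕ → ℚ) (m : ℕ) → conv f (suc m) ≡ conv (λ i j → f i (suc j)) m + f (suc m) 0
conv-snoc f zero = solve 2 (λ a b → a :+ (b :+ con 0ℚ) := (a :+ con 0ℚ) :+ b) refl (f 0 1) (f 1 0)
conv-snoc f (suc m) = begin
  conv f (suc (suc m))                                                       ≡⟨ conv-suc f (suc m) ⟩
  f 0 (suc (suc m)) + conv (f ∘ suc) (suc m)                                 ≡⟨ cong (f 0 (suc (suc m)) +_) (conv-snoc (f ∘ suc) m) ⟩
  f 0 (suc (suc m)) + (conv (λ i j → f (suc i) (suc j)) m + f (suc (suc m)) 0) ≡⟨ +-assoc (f 0 (suc (suc m))) (conv (λ i j → f (suc i) (suc j)) m) (f (suc (suc m)) 0) ⟨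
  f 0 (suc (suc m)) + conv (λ i j → f (suc i) (suc j)) m + f (suc (suc m)) 0   ≡⟨ cong (_+ f (suc (suc m)) 0) (conv-suc (λ i j → f i (suc j)) m) ⟨
  conv (λ i j → f i (suc j)) (suc m) + f (suc (suc m)) 0                     ∎

conv-flip : (f : ℕ → ℕ → ℚ) (m : ℕ) → conv f m ≡ conv (flip f) m
conv-flip f zero    = refl
conv-flip f (suc m) = begin
  conv f (suc m)                          ≡⟨ conv-suc f m ⟩
  f 0 (suc m) + conv (f ∘ suc) m          ≡⟨ +-comm (f 0 (suc m)) _ ⟩
  conv (f ∘ suc) m + f 0 (suc m)          ≡⟨ cong (_+ f 0 (suc m)) (conv-flip (f ∘ suc) m) ⟩
  conv (flip (f ∘ suc)) m + f 0 (suc m)   ≡⟨ conv-snoc (flip f) m ⟨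
  conv (flip f) (suc m)                   ∎

-- Both sides sum `f` over the triples with `a + b + l = m`. The induction splits off the triples
-- with `a = 0`; on the left these are scattered over the inner sums and have to be collected first.
conv-assoc : (f : ℕ → ℕ → ℕ → ℚ) (m : ℕ) →
             conv (λ i l → conv (λ a b → f a b l) i) m ≡ conv (λ a r → conv (λ b l → f a b l) r) m
conv-assoc f zero    = refl
conv-assoc f (suc m) = begin
  conv (λ i l → conv (λ a b → f a b l) i) (suc m)
    ≡⟨ conv-suc (λ i l → conv (λ a b → f a b l) i) m ⟩
  (f 0 0 (suc m) + 0ℚ) + conv (λ i l → conv (λ a b → f a b l) (suc i)) m
    ≡⟨ cong₂ _+_ (+-identityʳ (f 0 0 (suc m))) (conv-cong m λ i l → conv-suc (λ a b → f a b l) i) ⟩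
  f 0 0 (suc m) + conv (λ i l → f 0 (suc i) l + conv (λ a b → f (suc a) b l) i) m
    ≡⟨ cong (f 0 0 (suc m) +_) (conv-+ m (λ i l → f 0 (suc i) l) _) ⟩
  f 0 0 (suc m) + (conv (λ i l → f 0 (suc i) l) m + conv (λ i l → conv (λ a b → f (suc a) b l) i) m)
    ≡⟨ +-assoc (f 0 0 (suc m)) _ _ ⟨
  f 0 0 (suc m) + conv (λ i l → f 0 (suc i) l) m + conv (λ i l → conv (λ a b → f (suc a) b l) i) m
    ≡⟨ cong₂ _+_ (sym (conv-suc (f 0) m)) (conv-assoc (f ∘ suc) m) ⟩
  conv (f 0) (suc m) + conv (λ a r → conv (λ b l → f (suc a) b l) r) m
    ≡⟨ conv-suc (λ a r → conv (λ b l → f a b l) r) m ⟨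
  conv (λ a r → conv (λ b l → f a b l) r) (suc m) ∎

∑-upTo : (m : ℕ) (f : ℕ → ℕ → ℚ) → ∑ (upTo (suc m)) (λ i → f i (m ∸ i)) ≡ conv f m
∑-upTo zero    f = refl
∑-upTo (suc m) f = trans (cong (f 0 (suc m) +_) (begin
  ∑ (applyUpTo suc (suc m)) (λ i → f i (suc m ∸ i))    ≡⟨ cong (λ l → ∑ l (λ i → f i (suc m ∸ i))) (map-applyUpTo (λ i → i) suc (suc m)) ⟨
  ∑ (map suc (upTo (suc m))) (λ i → f i (suc m ∸ i))   ≡⟨ ∑-map suc (upTo (suc m)) (λ i → f i (suc m ∸ i)) ⟩
  ∑ (upTo (suc m)) (λ i → f (suc i) (m ∸ i))           ≡⟨ ∑-upTo m (f ∘ suc) ⟩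
  conv (f ∘ suc) m                                     ∎)) (sym (conv-suc f m))

-- The product of series, one variable at a time

_at_ : Series → ℕ → Series
(F at i) μ = F (i ∷ μ)

⊛-[] : (F G : Series) → (F ⊛ G) [] ≡ F [] * G []
⊛-[] F G = +-identityʳ _

-- This is the Cauchy product in the first variable, with coefficients that are series in the other
-- variables. It reduces commutativity and associativity to the same laws for shorter exponent lists
-- and to facts about `conv`.
⊛-∷ : (F G : Series) (m : ℕ) (μ : List ℕ) →
      (F ⊛ G) (m ∷ μ) ≡ conv (λ i j → ((F at i) ⊛ (G at j)) μ) m
⊛-∷ F G m μ = begin
  ∑ (concatMap (λ k → map (k ∷_) (below μ)) (upTo (suc m))) (λ ν → F ν * G (zipWith _∸_ (m ∷ μ) ν))
    ≡⟨ ∑-concatMap (λ k → map (k ∷_) (below μ)) (upTo (suc m)) _ ⟩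
  ∑ (upTo (suc m)) (λ k → ∑ (map (k ∷_) (below μ)) (λ ν → F ν * G (zipWith _∸_ (m ∷ μ) ν)))
    ≡⟨ ∑-cong (upTo (suc m)) (λ k → ∑-map (k ∷_) (below μ) _) ⟩
  ∑ (upTo (suc m)) (λ k → ((F at k) ⊛ (G at (m ∸ k))) μ)
    ≡⟨ ∑-upTo m (λ i j → ((F at i) ⊛ (G at j)) μ) ⟩
  conv (λ i j → ((F at i) ⊛ (G at j)) μ) m ∎

-- A product evaluates its factors only at exponent lists of the same length. This matters because
-- sums over fillings with entries up to `N` describe a series only at lists of length `N`.
⊛-cong-length : {F F′ G G′ : Series} (μ : List ℕ) →
                (∀ ν → length ν ≡ length μ → F ν ≡ F′ ν) →
                (∀ ν → length ν ≡ length μ → G ν ≡ G′ ν) → (F ⊛ G) μ ≡ (F′ ⊛ G′) μ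
⊛-cong-length []      f g = cong (_+ 0ℚ) (cong₂ _*_ (f [] refl) (g [] refl))
⊛-cong-length {F} {F′} {G} {G′} (m ∷ μ) f g = begin
  (F ⊛ G) (m ∷ μ)                             ≡⟨ ⊛-∷ F G m μ ⟩
  conv (λ i j → ((F at i) ⊛ (G at j)) μ) m    ≡⟨ conv-cong m (λ i j → ⊛-cong-length μ
                                                   (λ ν e → f (i ∷ ν) (cong suc e)) (λ ν e → g (j ∷ ν) (cong suc e))) ⟩
  conv (λ i j → ((F′ at i) ⊛ (G′ at j)) μ) m  ≡⟨ ⊛-∷ F′ G′ m μ ⟨
  (F′ ⊛ G′) (m ∷ μ)                           ∎

⊛-cong : {F F′ G G′ : Series} → F ≈ₛ F′ → G ≈ₛ G′ → (F ⊛ G) ≈ₛ (F′ ⊛ G′)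
⊛-cong f g μ = ⊛-cong-length μ (λ ν _ → f ν) (λ ν _ → g ν)

⊛-congˡ : {F F′ : Series} (G : Series) → F ≈ₛ F′ → (F ⊛ G) ≈ₛ (F′ ⊛ G)
⊛-congˡ G f = ⊛-cong {G = G} f (λ _ → refl)

⊛-congʳ : (F : Series) {G G′ : Series} → G ≈ₛ G′ → (F ⊛ G) ≈ₛ (F ⊛ G′)
⊛-congʳ F g = ⊛-cong {F = F} (λ _ → refl) g

⊛-comm : (F G : Series) → (F ⊛ G) ≈ₛ (G ⊛ F)
⊛-comm F G []      = cong (_+ 0ℚ) (*-comm (F []) (G []))
⊛-comm F G (m ∷ μ) = begin
  (F ⊛ G) (m ∷ μ)                            ≡⟨ ⊛-∷ F G m μ ⟩
  conv (λ i j → ((F at i) ⊛ (G at j)) μ) m   ≡⟨ conv-cong m (λ i j → ⊛-comm (F at i) (G at j) μ) ⟩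
  conv (λ i j → ((G at j) ⊛ (F at i)) μ) m   ≡⟨ conv-flip _ m ⟩
  conv (λ i j → ((G at i) ⊛ (F at j)) μ) m   ≡⟨ ⊛-∷ G F m μ ⟨
  (G ⊛ F) (m ∷ μ)                            ∎

⊛-∑ˡ : {A : Set} (xs : List A) (f : A → Series) (G : Series) →
       ((λ ν → ∑ xs (λ x → f x ν)) ⊛ G) ≈ₛ (λ μ → ∑ xs (λ x → (f x ⊛ G) μ))
⊛-∑ˡ xs f G μ = trans (∑-cong (below μ) (λ ν → sym (∑-*ʳ xs _ (λ x → f x ν)))) (∑-swap (below μ) xs _)

⊛-∑ʳ : {A : Set} (F : Series) (xs : List A) (g : A → Series) →
       (F ⊛ (λ ν → ∑ xs (λ x → g x ν))) ≈ₛ (λ μ → ∑ xs (λ x → (F ⊛ g x) μ))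
⊛-∑ʳ F xs g μ = trans (∑-cong (below μ) (λ ν → sym (∑-*ˡ xs (F ν) _))) (∑-swap (below μ) xs _)

⊛-⋆ˡ : (c : ℚ) (F G : Series) → ((c ⋆ F) ⊛ G) ≈ₛ (c ⋆ (F ⊛ G))
⊛-⋆ˡ c F G μ = trans (∑-cong (below μ) (λ ν → *-assoc c (F ν) _)) (∑-*ˡ (below μ) c _)

⊛-⋆ʳ : (c : ℚ) (F G : Series) → (F ⊛ (c ⋆ G)) ≈ₛ (c ⋆ (F ⊛ G))
⊛-⋆ʳ c F G μ = trans (⊛-comm F (c ⋆ G) μ) (trans (⊛-⋆ˡ c G F μ) (cong (c *_) (⊛-comm G F μ)))

⊛-distribʳ-⊕ : (F G H : Series) → ((F ⊕ G) ⊛ H) ≈ₛ ((F ⊛ H) ⊕ (G ⊛ H))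
⊛-distribʳ-⊕ F G H μ = trans (∑-cong (below μ) (λ ν → *-distribʳ-+ _ (F ν) (G ν))) (∑-+ (below μ) _ _)

⊛-distribˡ-⊕ : (F G H : Series) → (F ⊛ (G ⊕ H)) ≈ₛ ((F ⊛ G) ⊕ (F ⊛ H))
⊛-distribˡ-⊕ F G H μ = trans (∑-cong (below μ) (λ ν → *-distribˡ-+ (F ν) _ _)) (∑-+ (below μ) _ _)

⊛-assoc : (F G H : Series) → ((F ⊛ G) ⊛ H) ≈ₛ (F ⊛ (G ⊛ H))
⊛-assoc F G H []      =
  solve 3 (λ a b c → (a :* b :+ con 0ℚ) :* c :+ con 0ℚ := a :* (b :* c :+ con 0ℚ) :+ con 0ℚ) refl (F []) (G []) (H [])
⊛-assoc F G H (m ∷ μ) = begin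
  ((F ⊛ G) ⊛ H) (m ∷ μ)
    ≡⟨ ⊛-∷ (F ⊛ G) H m μ ⟩
  conv (λ i l → (((F ⊛ G) at i) ⊛ (H at l)) μ) m
    ≡⟨ conv-cong m (λ i l → trans (⊛-congˡ (H at l) (⊛-∷ F G i) μ) (⊛-∑ˡ (antidiagonal i) (λ (a , b) → (F at a) ⊛ (G at b)) (H at l) μ)) ⟩
  conv (λ i l → conv (λ a b → (((F at a) ⊛ (G at b)) ⊛ (H at l)) μ) i) m
    ≡⟨ conv-cong m (λ i l → conv-cong i (λ a b → ⊛-assoc (F at a) (G at b) (H at l) μ)) ⟩
  conv (λ i l → conv (λ a b → ((F at a) ⊛ ((G at b) ⊛ (H at l))) μ) i) m
    ≡⟨ conv-assoc (λ a b l → ((F at a) ⊛ ((G at b) ⊛ (H at l))) μ) m ⟩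
  conv (λ a r → conv (λ b l → ((F at a) ⊛ ((G at b) ⊛ (H at l))) μ) r) m
    ≡⟨ conv-cong m (λ a r → trans (⊛-congʳ (F at a) (⊛-∷ G H r) μ) (⊛-∑ʳ (F at a) (antidiagonal r) (λ (b , l) → (G at b) ⊛ (H at l)) μ)) ⟨
  conv (λ a r → ((F at a) ⊛ ((G ⊛ H) at r)) μ) m
    ≡⟨ ⊛-∷ F (G ⊛ H) m μ ⟨
  (F ⊛ (G ⊛ H)) (m ∷ μ) ∎

⊛-zeroˡ : (F : Series) → (zeroS ⊛ F) ≈ₛ zeroS
⊛-zeroˡ F μ = trans (∑-cong (below μ) (λ ν → *-zeroˡ (F (zipWith _∸_ μ ν)))) (∑-zero (below μ))

conv-single : (f : ℕ → ℕ → ℚ) (m : ℕ) → (∀ i j → f (suc i) j ≡ 0ℚ) → conv f m ≡ f 0 m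
conv-single f zero    z = +-identityʳ _
conv-single f (suc m) z = begin
  conv f (suc m)                   ≡⟨ conv-suc f m ⟩
  f 0 (suc m) + conv (f ∘ suc) m   ≡⟨ cong (f 0 (suc m) +_) (trans (conv-cong m z) (∑-zero (antidiagonal m))) ⟩
  f 0 (suc m) + 0ℚ                 ≡⟨ +-identityʳ _ ⟩
  f 0 (suc m)                      ∎

⊛-identityˡ : (F : Series) → (oneS ⊛ F) ≈ₛ F
⊛-identityˡ F []      = trans (⊛-[] oneS F) (*-identityˡ (F []))
⊛-identityˡ F (m ∷ μ) = begin
  (oneS ⊛ F) (m ∷ μ)                             ≡⟨ ⊛-∷ oneS F m μ ⟩
  conv (λ i j → ((oneS at i) ⊛ (F at j)) μ) m    ≡⟨ conv-single _ m (λ i j → ⊛-zeroˡ (F at j) μ) ⟩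
  (oneS ⊛ (F at m)) μ                            ≡⟨ ⊛-identityˡ (F at m) μ ⟩
  F (m ∷ μ)                                      ∎

⊛-leftComm : (F G H : Series) → (F ⊛ (G ⊛ H)) ≈ₛ (G ⊛ (F ⊛ H))
⊛-leftComm F G H μ = begin
  (F ⊛ (G ⊛ H)) μ   ≡⟨ ⊛-assoc F G H μ ⟨
  ((F ⊛ G) ⊛ H) μ   ≡⟨ ⊛-congˡ H (⊛-comm F G) μ ⟩
  ((G ⊛ F) ⊛ H) μ   ≡⟨ ⊛-assoc G F H μ ⟩
  (G ⊛ (F ⊛ H)) μ   ∎

-- Weakly increasing words and complete homogeneous functions

≡ᵇ-refl : ∀ n → (n ≡ᵇ n) ≡ true
≡ᵇ-refl zero    = refl
≡ᵇ-refl (suc n) = ≡ᵇ-refl n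

<⇒≢ᵇ : ∀ {m n} → m < n → (m ≡ᵇ n) ≡ false
<⇒≢ᵇ {zero}  {suc n} _         = refl
<⇒≢ᵇ {suc m} {suc n} (s≤s m<n) = <⇒≢ᵇ m<n

>⇒≢ᵇ : ∀ {m n} → n < m → (m ≡ᵇ n) ≡ false
>⇒≢ᵇ {suc m} {zero}  _         = refl
>⇒≢ᵇ {suc m} {suc n} (s≤s n<m) = >⇒≢ᵇ n<m

<⇒<ᵇ : ∀ {m n} → m < n → (m <ᵇ n) ≡ true
<⇒<ᵇ {zero}  {suc n} _         = refl
<⇒<ᵇ {suc m} {suc n} (s≤s m<n) = <⇒<ᵇ m<n

≥⇒≮ᵇ : ∀ {m n} → n ≤ m → (m <ᵇ n) ≡ false
≥⇒≮ᵇ {m}     {zero}  _         = refl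
≥⇒≮ᵇ {suc m} {suc n} (s≤s n≤m) = ≥⇒≮ᵇ n≤m

All-concatMap : {A B : Set} {P : B → Set} (k : A → List B) (xs : List A) →
                All (λ x → All P (k x)) xs → All P (concatMap k xs)
All-concatMap k xs ps = All.concat⁺ (All.map⁺ ps)

monomial : List ℕ → Series
monomial x μ = if eqList x μ then 1ℚ else 0ℚ

δ : ℕ → ℕ → ℚ
δ a i = if a ≡ᵇ i then 1ℚ else 0ℚ

conv-δ : (a b m : ℕ) → conv (λ i j → δ a i * δ b j) m ≡ δ (a ℕ.+ b) m
conv-δ zero    b m       =
  trans (conv-single (λ i j → δ 0 i * δ b j) m (λ i j → *-zeroˡ (δ b j))) (*-identityˡ (δ b m))
conv-δ (suc a) b zero    = trans (+-identityʳ (0ℚ * δ b 0)) (*-zeroˡ (δ b 0))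
conv-δ (suc a) b (suc m) = begin
  conv (λ i j → δ (suc a) i * δ b j) (suc m)             ≡⟨ conv-suc (λ i j → δ (suc a) i * δ b j) m ⟩
  0ℚ * δ b (suc m) + conv (λ i j → δ a i * δ b j) m      ≡⟨ cong₂ _+_ (*-zeroˡ (δ b (suc m))) (conv-δ a b m) ⟩
  0ℚ + δ (a ℕ.+ b) m                                     ≡⟨ +-identityˡ (δ (a ℕ.+ b) m) ⟩
  δ (a ℕ.+ b) m                                          ∎

monomial-∷ : (a : ℕ) (x : List ℕ) (m : ℕ) (μ : List ℕ) → monomial (a ∷ x) (m ∷ μ) ≡ δ a m * monomial x μ
monomial-∷ a x m μ with a ≡ᵇ m
... | true  = sym (*-identityˡ (monomial x μ))
... | false = sym (*-zeroˡ (monomial x μ))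

monomial-⊛ : (x y μ : List ℕ) → length x ≡ length μ → length y ≡ length μ →
             (monomial x ⊛ monomial y) μ ≡ monomial (zipWith ℕ._+_ x y) μ
monomial-⊛ []      []      []      _ _ = refl
monomial-⊛ (a ∷ x) (b ∷ y) (m ∷ μ) p r = begin
  (monomial (a ∷ x) ⊛ monomial (b ∷ y)) (m ∷ μ)
    ≡⟨ ⊛-∷ (monomial (a ∷ x)) (monomial (b ∷ y)) m μ ⟩
  conv (λ i j → ((monomial (a ∷ x) at i) ⊛ (monomial (b ∷ y) at j)) μ) m
    ≡⟨ conv-cong m (λ i j → trans (⊛-cong (monomial-∷ a x i) (monomial-∷ b y j) μ)
                           (trans (⊛-⋆ˡ (δ a i) (monomial x) (δ b j ⋆ monomial y) μ)
                                  (cong (δ a i *_) (⊛-⋆ʳ (δ b j) (monomial x) (monomial y) μ)))) ⟩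
  conv (λ i j → δ a i * (δ b j * (monomial x ⊛ monomial y) μ)) m
    ≡⟨ conv-cong m (λ i j → sym (*-assoc (δ a i) (δ b j) _)) ⟩
  conv (λ i j → δ a i * δ b j * (monomial x ⊛ monomial y) μ) m
    ≡⟨ ∑-*ʳ (antidiagonal m) _ (λ (i , j) → δ a i * δ b j) ⟩
  conv (λ i j → δ a i * δ b j) m * (monomial x ⊛ monomial y) μ
    ≡⟨ cong₂ _*_ (conv-δ a b m) (monomial-⊛ x y μ (ℕ.suc-injective p) (ℕ.suc-injective r)) ⟩
  δ (a ℕ.+ b) m * monomial (zipWith ℕ._+_ x y) μ
    ≡⟨ monomial-∷ (a ℕ.+ b) (zipWith ℕ._+_ x y) m μ ⟨
  monomial (zipWith ℕ._+_ (a ∷ x) (b ∷ y)) (m ∷ μ) ∎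

-- The exponent vector of a word in the `k` variables from number `lo` on; the moving start allows
-- recursion on the number of variables. By `map-count`, `counts 1 N` computes `contentVec N`.
counts : ℕ → ℕ → List ℕ → List ℕ
counts lo zero    u = []
counts lo (suc k) u = count lo u ∷ counts (suc lo) k u

length-counts : ∀ lo k u → length (counts lo k u) ≡ k
length-counts lo zero    u = refl
length-counts lo (suc k) u = cong suc (length-counts (suc lo) k u)

map-shift-upTo : {A : Set} (f : ℕ → A) (n : ℕ) → map f (upTo (suc n)) ≡ f 0 ∷ map (f ∘ suc) (upTo n)
map-shift-upTo f n = cong (f 0 ∷_) (trans (map-applyUpTo suc f n) (sym (map-applyUpTo (λ i → i) (f ∘ suc) n)))

map-count : (lo N : ℕ) (u : List ℕ) → map (λ i → count (lo ℕ.+ i) u) (upTo N) ≡ counts lo N u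
map-count lo zero    u = refl
map-count lo (suc N) u = begin
  map (λ i → count (lo ℕ.+ i) u) (upTo (suc N))
    ≡⟨ map-shift-upTo (λ i → count (lo ℕ.+ i) u) N ⟩
  count (lo ℕ.+ 0) u ∷ map (λ i → count (lo ℕ.+ suc i) u) (upTo N)
    ≡⟨ cong₂ _∷_ (cong (λ l → count l u) (ℕ.+-identityʳ lo))
                 (map-cong (λ i → cong (λ l → count l u) (ℕ.+-suc lo i)) (upTo N)) ⟩
  count lo u ∷ map (λ i → count (suc lo ℕ.+ i) u) (upTo N)
    ≡⟨ cong (count lo u ∷_) (map-count (suc lo) N u) ⟩
  counts lo (suc N) u ∎

count-++ : (k : ℕ) (u v : List ℕ) → count k (u ++ v) ≡ count k u ℕ.+ count k v
count-++ k []      v = refl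
count-++ k (x ∷ u) v = trans (cong ((if x ≡ᵇ k then 1 else 0) ℕ.+_) (count-++ k u v)) (sym (ℕ.+-assoc (if x ≡ᵇ k then 1 else 0) _ _))

counts-++ : (lo k : ℕ) (u v : List ℕ) → counts lo k (u ++ v) ≡ zipWith ℕ._+_ (counts lo k u) (counts lo k v)
counts-++ lo zero    u v = refl
counts-++ lo (suc k) u v = cong₂ _∷_ (count-++ lo u v) (counts-++ (suc lo) k u v)

counts-cong : {u v : List ℕ} → (∀ i → count i u ≡ count i v) → ∀ lo k → counts lo k u ≡ counts lo k v
counts-cong e lo zero    = refl
counts-cong e lo (suc k) = cong₂ _∷_ (e lo) (counts-cong e (suc lo) k)

counts-skip : ∀ {e lo} → e < lo → (k : ℕ) (u : List ℕ) → counts lo k (e ∷ u) ≡ counts lo k u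
counts-skip e<lo zero    u = refl
counts-skip {e} {lo} e<lo (suc k) u =
  cong₂ _∷_ (cong (λ b → (if b then 1 else 0) ℕ.+ count lo u) (<⇒≢ᵇ e<lo)) (counts-skip (ℕ.m<n⇒m<1+n e<lo) k u)

count-above : ∀ {lo u} → All (lo <_) u → count lo u ≡ 0
count-above []       = refl
count-above {lo} {_ ∷ u} (p ∷ ps) = trans (cong (λ b → (if b then 1 else 0) ℕ.+ count lo u) (>⇒≢ᵇ p)) (count-above ps)

range : ℕ → ℕ → List ℕ
range lo N = map (lo ℕ.+_) (upTo (suc N ∸ lo))

range-∷ : ∀ {lo N} → lo ≤ N → range lo N ≡ lo ∷ range (suc lo) N
range-∷ {lo} {N} lo≤N rewrite ℕ.+-∸-assoc 1 lo≤N = begin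
  map (lo ℕ.+_) (upTo (suc (N ∸ lo)))                        ≡⟨ map-shift-upTo (lo ℕ.+_) (N ∸ lo) ⟩
  lo ℕ.+ 0 ∷ map (λ i → lo ℕ.+ suc i) (upTo (N ∸ lo))        ≡⟨ cong₂ _∷_ (ℕ.+-identityʳ lo) (map-cong (ℕ.+-suc lo) (upTo (N ∸ lo))) ⟩
  lo ∷ map (suc lo ℕ.+_) (upTo (N ∸ lo))                     ∎

range-[] : ∀ {lo N} → N < lo → range lo N ≡ []
range-[] {lo} N<lo rewrite ℕ.m≤n⇒m∸n≡0 N<lo = refl

range-≥ : ∀ lo N → All (lo ≤_) (range lo N)
range-≥ lo N = All.map⁺ (All.universal (ℕ.m≤m+n lo) (upTo (suc N ∸ lo)))

weakIncr-length : ∀ c lo N → All (λ u → length u ≡ c) (weakIncr c lo N)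
weakIncr-length zero    lo N = refl ∷ []
weakIncr-length (suc c) lo N = All-concatMap _ (range lo N)
  (All.universal (λ e → All.map⁺ (All.map (cong suc) (weakIncr-length c e N))) (range lo N))

weakIncr-≥ : ∀ c lo N → All (All (lo ≤_)) (weakIncr c lo N)
weakIncr-≥ zero    lo N = [] ∷ []
weakIncr-≥ (suc c) lo N = All-concatMap _ (range lo N)
  (All.map (λ {e} lo≤e → All.map⁺ (All.map (λ ps → lo≤e ∷ All.map (ℕ.≤-trans lo≤e) ps) (weakIncr-≥ c e N))) (range-≥ lo N))

weakIncr-split : ∀ c {lo N} → lo ≤ N → weakIncr (suc c) lo N ≡ map (lo ∷_) (weakIncr c lo N) ++ weakIncr (suc c) (suc lo) N
weakIncr-split c {lo} {N} lo≤N = cong (concatMap (λ e → map (e ∷_) (weakIncr c e N))) (range-∷ lo≤N)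

monomial-counts-[] : (lo : ℕ) (ν : List ℕ) → monomial (counts lo (length ν) []) ν ≡ h 0 ν
monomial-counts-[] lo []          = refl
monomial-counts-[] lo (zero  ∷ ν) = monomial-counts-[] (suc lo) ν
monomial-counts-[] lo (suc m ∷ ν) = refl

-- A weakly increasing word over letters from `lo` on either starts with `lo`, and removing that
-- letter lowers its multiplicity by one, or contains no `lo` at all.
∑-weakIncr-suc : (m : ℕ) (ν : List ℕ) (c lo N : ℕ) → lo ≤ N →
  ∑ (weakIncr (suc c) lo N) (λ u → monomial (counts lo (suc (length ν)) u) (m ∷ ν)) ≡
  ∑ (weakIncr c lo N) (λ u → monomial (suc (count lo u) ∷ counts (suc lo) (length ν) u) (m ∷ ν)) +
  ∑ (weakIncr (suc c) (suc lo) N) (λ u → monomial (0 ∷ counts (suc lo) (length ν) u) (m ∷ ν))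
∑-weakIncr-suc m ν c lo N lo≤N = begin
  ∑ (weakIncr (suc c) lo N) X
    ≡⟨ cong (λ l → ∑ l X) (weakIncr-split c lo≤N) ⟩
  ∑ (map (lo ∷_) (weakIncr c lo N) ++ weakIncr (suc c) (suc lo) N) X
    ≡⟨ ∑-++ (map (lo ∷_) (weakIncr c lo N)) (weakIncr (suc c) (suc lo) N) X ⟩
  ∑ (map (lo ∷_) (weakIncr c lo N)) X + ∑ (weakIncr (suc c) (suc lo) N) X
    ≡⟨ cong₂ _+_ (trans (∑-map (lo ∷_) (weakIncr c lo N) X) (∑-cong (weakIncr c lo N) first))
                 (∑-congᴬ (All.map rest (weakIncr-≥ (suc c) (suc lo) N))) ⟩
  _ ∎
  where
  X : List ℕ → ℚ
  X u = monomial (counts lo (suc (length ν)) u) (m ∷ ν)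
  first : ∀ u → X (lo ∷ u) ≡ monomial (suc (count lo u) ∷ counts (suc lo) (length ν) u) (m ∷ ν)
  first u = cong (λ x → monomial x (m ∷ ν))
    (cong₂ _∷_ (cong (λ b → (if b then 1 else 0) ℕ.+ count lo u) (≡ᵇ-refl lo)) (counts-skip (ℕ.n<1+n lo) (length ν) u))
  rest : ∀ {u} → All (suc lo ≤_) u → X u ≡ monomial (0 ∷ counts (suc lo) (length ν) u) (m ∷ ν)
  rest {u} ps = cong (λ x → monomial (x ∷ counts (suc lo) (length ν) u) (m ∷ ν)) (count-above ps)

+-suc-≤ : ∀ {lo k N} → lo ℕ.+ suc k ≡ suc N → lo ≤ N
+-suc-≤ {lo} {k} e = ℕ.≤-trans (ℕ.m≤m+n lo k) (ℕ.≤-reflexive (ℕ.suc-injective (trans (sym (ℕ.+-suc lo k)) e)))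

-- Each monomial of degree `c` comes from exactly one weakly increasing word. The recursion finds
-- it: an exponent 0 leaves only the words that avoid `lo`, a positive exponent only those that
-- start with `lo`. The equation on `N` says that the letters from `lo` to `N` are exactly the
-- variables of `ν`.
h-weakIncr : (ν : List ℕ) (c lo N : ℕ) → lo ℕ.+ length ν ≡ suc N →
             ∑ (weakIncr c lo N) (λ u → monomial (counts lo (length ν) u) ν) ≡ h c ν
h-weakIncr ν            zero    lo N e = trans (+-identityʳ _) (monomial-counts-[] lo ν)
h-weakIncr []           (suc c) lo N e
  rewrite range-[] {lo} {N} (ℕ.≤-reflexive (sym (trans (sym (ℕ.+-identityʳ lo)) e))) = refl
h-weakIncr (zero ∷ ν)  (suc c) lo N e = begin
  _               ≡⟨ ∑-weakIncr-suc 0 ν c lo N (+-suc-≤ e) ⟩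
  _               ≡⟨ cong₂ _+_ (∑-zero (weakIncr c lo N)) (h-weakIncr ν (suc c) (suc lo) N (trans (sym (ℕ.+-suc lo _)) e)) ⟩
  0ℚ + h (suc c) ν ≡⟨ +-identityˡ (h (suc c) ν) ⟩
  h (suc c) ν     ∎
h-weakIncr (suc m ∷ ν) (suc c) lo N e = begin
  _                      ≡⟨ ∑-weakIncr-suc (suc m) ν c lo N (+-suc-≤ e) ⟩
  _                      ≡⟨ cong₂ _+_ (h-weakIncr (m ∷ ν) c lo N e) (∑-zero (weakIncr (suc c) (suc lo) N)) ⟩
  h c (m ∷ ν) + 0ℚ       ≡⟨ +-identityʳ (h c (m ∷ ν)) ⟩
  h (suc c) (suc m ∷ ν)  ∎

-- With the current lower bound as default, the result is the lower bound for the letter after `v`,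
-- for empty `v` as well.
lastOr : ℕ → List ℕ → ℕ
lastOr l []      = l
lastOr l (x ∷ v) = lastOr x v

lastOr-≥ : ∀ {k l v} → k ≤ l → All (k ≤_) v → k ≤ lastOr l v
lastOr-≥ p []       = p
lastOr-≥ _ (p ∷ ps) = lastOr-≥ p ps

∑-weakIncr-++ : (d c lo N : ℕ) (f : List ℕ → ℚ) → ∑ (weakIncr (d ℕ.+ c) lo N) f ≡
  ∑ (weakIncr d lo N) (λ v → ∑ (weakIncr c (lastOr lo v) N) (λ u → f (v ++ u)))
∑-weakIncr-++ zero    c lo N f = sym (+-identityʳ _)
∑-weakIncr-++ (suc d) c lo N f = begin
  ∑ (weakIncr (suc d ℕ.+ c) lo N) f
    ≡⟨ ∑-concatMap (λ e → map (e ∷_) (weakIncr (d ℕ.+ c) e N)) (range lo N) f ⟩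
  ∑ (range lo N) (λ e → ∑ (map (e ∷_) (weakIncr (d ℕ.+ c) e N)) f)
    ≡⟨ ∑-cong (range lo N) (λ e → trans (∑-map (e ∷_) (weakIncr (d ℕ.+ c) e N) f) (∑-weakIncr-++ d c e N (f ∘ (e ∷_)))) ⟩
  ∑ (range lo N) (λ e → ∑ (weakIncr d e N) (λ v → F (e ∷ v)))
    ≡⟨ ∑-cong (range lo N) (λ e → ∑-map (e ∷_) (weakIncr d e N) F) ⟨
  ∑ (range lo N) (λ e → ∑ (map (e ∷_) (weakIncr d e N)) F)
    ≡⟨ ∑-concatMap (λ e → map (e ∷_) (weakIncr d e N)) (range lo N) F ⟨
  ∑ (weakIncr (suc d) lo N) F ∎
  where
  F : List ℕ → ℚ
  F v = ∑ (weakIncr c (lastOr lo v) N) (λ u → f (v ++ u))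

-- The bound is written as `t + a` for an induction on the excess `t`: each step adds the letter `a`
-- to the range, with summand 0.
∑-range-from : (t a N : ℕ) (X : ℕ → ℚ) →
  ∑ (range (t ℕ.+ a) N) X ≡ ∑ (range a N) (λ e → if e <ᵇ t ℕ.+ a then 0ℚ else X e)
∑-range-from zero    a N X = ∑-congᴬ (All.map (λ {e} a≤e → cong (if_then 0ℚ else X e) (sym (≥⇒≮ᵇ a≤e))) (range-≥ a N))
∑-range-from (suc t) a N X with a ℕ.≤? N
... | no a≰N rewrite range-[] {a} {N} (ℕ.≰⇒> a≰N) | range-[] {suc t ℕ.+ a} {N} (ℕ.≤-trans (ℕ.≰⇒> a≰N) (ℕ.m≤n+m a (suc t))) = refl
... | yes a≤N = begin
  ∑ (range (suc t ℕ.+ a) N) X        ≡⟨ cong (λ l → ∑ (range l N) X) (ℕ.+-suc t a) ⟨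
  ∑ (range (t ℕ.+ suc a) N) X        ≡⟨ ∑-range-from t (suc a) N X ⟩
  ∑ (range (suc a) N) (λ e → if e <ᵇ t ℕ.+ suc a then 0ℚ else X e)
    ≡⟨ cong (λ l → ∑ (range (suc a) N) (λ e → if e <ᵇ l then 0ℚ else X e)) (ℕ.+-suc t a) ⟩
  ∑ (range (suc a) N) Y              ≡⟨ +-identityˡ _ ⟨
  0ℚ + ∑ (range (suc a) N) Y         ≡⟨ cong (λ b → (if b then 0ℚ else X a) + ∑ (range (suc a) N) Y) (<⇒<ᵇ (ℕ.m<n+m a {suc t} (s≤s z≤n))) ⟨
  ∑ (a ∷ range (suc a) N) Y          ≡⟨ cong (λ l → ∑ l Y) (range-∷ a≤N) ⟨
  ∑ (range a N) Y                    ∎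
  where
  Y : ℕ → ℚ
  Y e = if e <ᵇ suc t ℕ.+ a then 0ℚ else X e

-- The test for a descent between a letter `l` and a word placed after it; an empty word makes none.
startsBelow : ℕ → List ℕ → Bool
startsBelow l []      = false
startsBelow l (e ∷ u) = e <ᵇ l

-- When a word is cut in two, the lower bound of the second piece depends on the first. Turning the
-- bound into vanishing summands over a fixed list makes the two sums exchangeable.
∑-weakIncr-from : (c N : ℕ) {lo : ℕ} → 1 ≤ lo → (f : List ℕ → ℚ) →
  ∑ (weakIncr c lo N) f ≡ ∑ (weakIncr c 1 N) (λ u → if startsBelow lo u then 0ℚ else f u)
∑-weakIncr-from zero    N _   f = refl
∑-weakIncr-from (suc c) N {lo} 1≤lo f = begin
  ∑ (weakIncr (suc c) lo N) f
    ≡⟨ ∑-concatMap k (range lo N) f ⟩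
  ∑ (range lo N) X
    ≡⟨ cong (λ l → ∑ (range l N) X) (ℕ.m∸n+n≡m 1≤lo) ⟨
  ∑ (range (lo ∸ 1 ℕ.+ 1) N) X
    ≡⟨ ∑-range-from (lo ∸ 1) 1 N X ⟩
  ∑ (range 1 N) (λ e → if e <ᵇ lo ∸ 1 ℕ.+ 1 then 0ℚ else X e)
    ≡⟨ cong (λ l → ∑ (range 1 N) (λ e → if e <ᵇ l then 0ℚ else X e)) (ℕ.m∸n+n≡m 1≤lo) ⟩
  ∑ (range 1 N) (λ e → if e <ᵇ lo then 0ℚ else X e)
    ≡⟨ ∑-cong (range 1 N) pull ⟩
  ∑ (range 1 N) (λ e → ∑ (k e) Y)
    ≡⟨ ∑-concatMap k (range 1 N) Y ⟨
  ∑ (weakIncr (suc c) 1 N) Y ∎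
  where
  k : ℕ → List (List ℕ)
  k e = map (e ∷_) (weakIncr c e N)
  X : ℕ → ℚ
  X e = ∑ (k e) f
  Y : List ℕ → ℚ
  Y u = if startsBelow lo u then 0ℚ else f u
  pull : ∀ e → (if e <ᵇ lo then 0ℚ else X e) ≡ ∑ (k e) Y
  pull e = trans (aux (e <ᵇ lo)) (sym (∑-map (e ∷_) (weakIncr c e N) Y))
    where
    aux : (b : Bool) → (if b then 0ℚ else X e) ≡ ∑ (weakIncr c e N) (λ u → if b then 0ℚ else f (e ∷ u))
    aux true  = sym (∑-zero (weakIncr c e N))
    aux false = ∑-map (e ∷_) (weakIncr c e N) f

-- Inversions of tuples of rows

cells : ℕ → List ℕ → FilledRow
cells s []      = []
cells s (e ∷ u) = (s , e) ∷ cells (suc s) u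

zip-cells : (s : ℕ) (u : List ℕ) → zip (map (s ℕ.+_) (upTo (length u))) u ≡ cells s u
zip-cells s []      = refl
zip-cells s (e ∷ u) = trans (cong (λ l → zip l (e ∷ u)) (map-shift-upTo (s ℕ.+_) (length u)))
  (cong₂ (λ s′ r → (s′ , e) ∷ r) (ℕ.+-identityʳ s)
    (trans (cong (λ l → zip l u) (map-cong (ℕ.+-suc s) (upTo (length u)))) (zip-cells (suc s) u)))

cells-++ : (s : ℕ) (u v : List ℕ) → cells s (u ++ v) ≡ cells s u ++ cells (s ℕ.+ length u) v
cells-++ s []      v = cong (λ t → cells t v) (sym (ℕ.+-identityʳ s))
cells-++ s (e ∷ u) v = cong ((s , e) ∷_)
  (trans (cells-++ (suc s) u v) (cong (λ t → cells (suc s) u ++ cells t v) (sym (ℕ.+-suc s (length u)))))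

cells-≥ : (s : ℕ) (u : List ℕ) → All (λ x → s ≤ proj₁ x) (cells s u)
cells-≥ s []      = []
cells-≥ s (e ∷ u) = ℕ.≤-refl ∷ All.map (ℕ.≤-trans (ℕ.n≤1+n s)) (cells-≥ (suc s) u)

cells-< : (s : ℕ) (u : List ℕ) → All (λ x → proj₁ x < s ℕ.+ length u) (cells s u)
cells-< s []      = []
cells-< s (e ∷ u) = ℕ.m<m+n s (s≤s z≤n)
  ∷ All.map (λ p → ℕ.<-≤-trans p (ℕ.≤-reflexive (sym (ℕ.+-suc s (length u))))) (cells-< (suc s) u)

map-proj₂-cells : (s : ℕ) (u : List ℕ) → map proj₂ (cells s u) ≡ u
map-proj₂-cells s []      = refl
map-proj₂-cells s (e ∷ u) = cong (e ∷_) (map-proj₂-cells (suc s) u)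

entries : List FilledRow → List ℕ
entries = concatMap (map proj₂)

entries-cells : (s : ℕ) (u : List ℕ) (Ts : List FilledRow) → entries (cells s u ∷ Ts) ≡ u ++ entries Ts
entries-cells s u Ts = cong (_++ entries Ts) (map-proj₂-cells s u)

∑-fillings : (N s c : ℕ) (f : FilledRow → ℚ) →
             ∑ (fillings N (s ℕ.+ c , s)) f ≡ ∑ (weakIncr c 1 N) (f ∘ cells s)
∑-fillings N s c f rewrite ℕ.m+n∸m≡n s c =
  trans (∑-map (zip (map (s ℕ.+_) (upTo c))) (weakIncr c 1 N) f)
        (∑-congᴬ (All.map (λ {u} e → cong f (trans (cong (λ n → zip (map (s ℕ.+_) (upTo n)) u) (sym e)) (zip-cells s u)))
                          (weakIncr-length c 1 N)))

∑-tuples : (N s c : ℕ) (rs : List Row) (f : List FilledRow → ℚ) →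
  ∑ (tuples N ((s ℕ.+ c , s) ∷ rs)) f ≡ ∑ (weakIncr c 1 N) (λ u → ∑ (tuples N rs) (λ Ts → f (cells s u ∷ Ts)))
∑-tuples N s c rs f = begin
  _ ≡⟨ ∑-concatMap (λ T → map (T ∷_) (tuples N rs)) (fillings N (s ℕ.+ c , s)) f ⟩
  _ ≡⟨ ∑-cong (fillings N (s ℕ.+ c , s)) (λ T → ∑-map (T ∷_) (tuples N rs) f) ⟩
  ∑ (fillings N (s ℕ.+ c , s)) (λ T → ∑ (tuples N rs) (λ Ts → f (T ∷ Ts)))
    ≡⟨ ∑-fillings N s c (λ T → ∑ (tuples N rs) (λ Ts → f (T ∷ Ts))) ⟩
  _ ∎

-- The rows of the path of the reversed composition: the head of the list is the topmost row.
rowsR : List ℕ → List Row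
rowsR []      = []
rowsR (c ∷ γ) = (sumℕ γ ℕ.+ c , sumℕ γ) ∷ rowsR γ

pathRows-reverse : (α : List ℕ) → pathRows α ≡ rowsR (reverse α)
pathRows-reverse α = go [] α
  where
  -- The accumulator of `reverse` holds the parts already passed; their rows are finished, and
  -- `rowsFrom` goes on at their sum.
  go : ∀ acc α → foldl (flip _∷_) (rowsR acc) (rowsFrom (sumℕ acc) α) ≡ rowsR (foldl (flip _∷_) acc α)
  go acc []      = refl
  go acc (a ∷ α) = trans
    (cong (λ s → foldl (flip _∷_) (rowsR (a ∷ acc)) (rowsFrom s α)) (ℕ.+-comm (sumℕ acc) a)) (go (a ∷ acc) α)

All-fillings : {P : FilledRow → Set} (N s c : ℕ) → (∀ u → length u ≡ c → P (cells s u)) → All P (fillings N (s ℕ.+ c , s))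
All-fillings {P} N s c p rewrite ℕ.m+n∸m≡n s c =
  All.map⁺ (All.map (λ {u} e → subst P (sym (trans (cong (λ n → zip (map (s ℕ.+_) (upTo n)) u) (sym e)) (zip-cells s u))) (p u e))
                    (weakIncr-length c 1 N))

tuples-below : (N : ℕ) (γ : List ℕ) → All (All (All (λ x → proj₁ x < sumℕ γ))) (tuples N (rowsR γ))
tuples-below N []      = [] ∷ []
tuples-below N (c ∷ γ) = All-concatMap _ (fillings N (sumℕ γ ℕ.+ c , sumℕ γ))
  (All-fillings N (sumℕ γ) c λ u e → All.map⁺ (All.map (λ ps →
      All.map (λ p → ℕ.<-≤-trans p (ℕ.≤-reflexive (trans (cong (sumℕ γ ℕ.+_) e) (ℕ.+-comm (sumℕ γ) c)))) (cells-< (sumℕ γ) u)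
    ∷ All.map (All.map (λ p → ℕ.<-≤-trans p (ℕ.m≤n+m (sumℕ γ) c))) ps) (tuples-below N γ)))

sumℕ-zero : {A : Set} {f : A → ℕ} {xs : List A} → All (λ x → f x ≡ 0) xs → sumℕ (map f xs) ≡ 0
sumℕ-zero []       = refl
sumℕ-zero (e ∷ es) = cong₂ ℕ._+_ e (sumℕ-zero es)

invCell-far : (x y : ℕ × ℕ) → suc (proj₁ y) < proj₁ x → invCell x y ≡ 0
invCell-far (c , e) (c′ , e′) p rewrite >⇒≢ᵇ p | >⇒≢ᵇ (ℕ.<-trans (ℕ.n<1+n c′) p) = refl

cross-far : (s : ℕ) {T T′ : FilledRow} → All (λ x → s ≤ proj₁ x) T → All (λ y → suc (proj₁ y) < s) T′ → cross T T′ ≡ 0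
cross-far s ps qs = sumℕ-zero (All.map (λ {x} p → sumℕ-zero (All.map (λ {y} q → invCell-far x y (ℕ.<-≤-trans q p)) qs)) ps)

cross-++ : (T U V : FilledRow) → cross (T ++ U) V ≡ cross T V ℕ.+ cross U V
cross-++ []      U V = refl
cross-++ (x ∷ T) U V = trans (cong (sumℕ (map (invCell x) V) ℕ.+_) (cross-++ T U V)) (sym (ℕ.+-assoc (sumℕ (map (invCell x) V)) _ _))

-- The cell sits one step beyond the right end of the lower row, so only the last cell of that row
-- has a content close enough. The contents then differ by exactly one, so the pair is an inversion
-- of the second kind, that is, a descent.
invCell-adjacent : (t e : ℕ) (x : ℕ) (v : List ℕ) →
  sumℕ (map (invCell (t ℕ.+ length (x ∷ v) , e)) (cells t (x ∷ v))) ≡ (if e <ᵇ lastOr x v then 1 else 0)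
invCell-adjacent t e x [] rewrite ℕ.+-suc t 0 | ℕ.+-identityʳ t | >⇒≢ᵇ (ℕ.n<1+n t) | ≡ᵇ-refl t = ℕ.+-identityʳ _
invCell-adjacent t e x (y ∷ v) = begin
  invCell (s , e) (t , x) ℕ.+ sumℕ (map (invCell (s , e)) (cells (suc t) (y ∷ v)))
    ≡⟨ cong (ℕ._+ sumℕ (map (invCell (s , e)) (cells (suc t) (y ∷ v)))) (invCell-far (s , e) (t , x) (ℕ.≤-trans (ℕ.m≤m+n (2 ℕ.+ t) (length v)) (ℕ.≤-reflexive 2+t+l≡s))) ⟩
  sumℕ (map (invCell (s , e)) (cells (suc t) (y ∷ v)))
    ≡⟨ cong (λ s → sumℕ (map (invCell (s , e)) (cells (suc t) (y ∷ v)))) (ℕ.+-suc t (length (y ∷ v))) ⟩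
  sumℕ (map (invCell (suc t ℕ.+ length (y ∷ v) , e)) (cells (suc t) (y ∷ v)))
    ≡⟨ invCell-adjacent (suc t) e y v ⟩
  (if e <ᵇ lastOr y v then 1 else 0) ∎
  where
  s = t ℕ.+ length (x ∷ y ∷ v)
  2+t+l≡s : 2 ℕ.+ t ℕ.+ length v ≡ s
  2+t+l≡s = trans (cong suc (sym (ℕ.+-suc t (length v)))) (sym (ℕ.+-suc t (suc (length v))))

-- From the second cell of the upper row on, contents exceed those of the lower row by at least two,
-- so only its first cell can take part in an inversion.
cross-adjacent : (t l : ℕ) (u v : List ℕ) → 0 < length v →
  cross (cells (t ℕ.+ length v) u) (cells t v) ≡ (if startsBelow (lastOr l v) u then 1 else 0)
cross-adjacent t l []      v       _ = refl
cross-adjacent t l (e ∷ u) (x ∷ v) _ = begin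
  sumℕ (map (invCell (s , e)) (cells t (x ∷ v))) ℕ.+ cross (cells (suc s) u) (cells t (x ∷ v))
    ≡⟨ cong₂ ℕ._+_ (invCell-adjacent t e x v) (cross-far (suc s) (cells-≥ (suc s) u) (All.map s≤s (cells-< t (x ∷ v)))) ⟩
  (if e <ᵇ lastOr x v then 1 else 0) ℕ.+ 0
    ≡⟨ ℕ.+-identityʳ _ ⟩
  (if e <ᵇ lastOr x v then 1 else 0) ∎
  where s = t ℕ.+ length (x ∷ v)

crosses-far : (s : ℕ) (u : List ℕ) {t : ℕ} {Us : List FilledRow} → t < s →
  All (All (λ x → proj₁ x < t)) Us → sumℕ (map (cross (cells s u)) Us) ≡ 0
crosses-far s u t<s ps = sumℕ-zero (All.map (λ qs → cross-far s (cells-≥ s u) (All.map (λ q → ℕ.<-≤-trans (s≤s q) t<s) qs)) ps)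

-- As `v` is non-empty, it separates the top row from the rows in `Us` by at least two contents, and
-- the only new inversion is the one at the cut between `v` and `u`.
inv-adjacent : (t l : ℕ) (u v : List ℕ) (Us : List FilledRow) → 0 < length v → All (All (λ x → proj₁ x < t)) Us →
  inv (cells (t ℕ.+ length v) u ∷ cells t v ∷ Us) ≡ (if startsBelow (lastOr l v) u then 1 else 0) ℕ.+ inv (cells t v ∷ Us)
inv-adjacent t l u v Us 0<v ps = cong (ℕ._+ inv (cells t v ∷ Us)) (trans
  (cong₂ ℕ._+_ (cross-adjacent t l u v 0<v) (crosses-far (t ℕ.+ length v) u (ℕ.m<m+n t 0<v) ps)) (ℕ.+-identityʳ _))

-- The cells of `u` appended to a non-empty `v` have contents above `t`, while those in `Us` are
-- below `t`; such cells never form an inversion.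
inv-merged : (t : ℕ) (u v : List ℕ) (Us : List FilledRow) → 0 < length v → All (All (λ x → proj₁ x < t)) Us →
  inv (cells t (v ++ u) ∷ Us) ≡ inv (cells t v ∷ Us)
inv-merged t u v Us 0<v ps = cong (ℕ._+ inv Us) (begin
  sumℕ (map (cross (cells t (v ++ u))) Us)                            ≡⟨ cong (λ T → sumℕ (map (cross T) Us)) (cells-++ t v u) ⟩
  sumℕ (map (cross (cells t v ++ cells (t ℕ.+ length v) u)) Us)       ≡⟨ go ps ⟩
  sumℕ (map (cross (cells t v)) Us)                                   ∎)
  where
  go : ∀ {Us} → All (All (λ x → proj₁ x < t)) Us →
       sumℕ (map (cross (cells t v ++ cells (t ℕ.+ length v) u)) Us) ≡ sumℕ (map (cross (cells t v)) Us)
  go []                  = refl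
  go {U ∷ _} (qs ∷ qss) = cong₂ ℕ._+_ (begin
    cross (cells t v ++ cells (t ℕ.+ length v) u) U             ≡⟨ cross-++ (cells t v) _ U ⟩
    cross (cells t v) U ℕ.+ cross (cells (t ℕ.+ length v) u) U  ≡⟨ cong (cross (cells t v) U ℕ.+_)
      (cross-far (t ℕ.+ length v) (cells-≥ _ u) (All.map (λ q → ℕ.<-≤-trans (s≤s q) (ℕ.m<m+n t 0<v)) qs)) ⟩
    cross (cells t v) U ℕ.+ 0                                   ≡⟨ ℕ.+-identityʳ _ ⟩
    cross (cells t v) U                                         ∎) (go qss)

-- LLT polynomials as weighted sums over words

module _ (q : ℚ) where

  weight : ℕ → List FilledRow → Series
  weight N Ts = (q ^ℚ inv Ts) ⋆ monomial (counts 1 N (entries Ts))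

  LLT-weight : (rs : List Row) {N : ℕ} (μ : List ℕ) → length μ ≡ N → LLT q rs μ ≡ ∑ (tuples N rs) (λ Ts → weight N Ts μ)
  LLT-weight rs μ refl = ∑-cong (tuples (length μ) rs) λ Ts →
    trans (if-* (eqList (contentVec (length μ) Ts) μ) (q ^ℚ inv Ts))
          (cong (λ x → q ^ℚ inv Ts * monomial x μ) (map-count 1 (length μ) (entries Ts)))
    where
    if-* : (b : Bool) (w : ℚ) → (if b then w else 0ℚ) ≡ w * (if b then 1ℚ else 0ℚ)
    if-* true  w = sym (*-identityʳ w)
    if-* false w = sym (*-zeroʳ w)

  -- The path polynomial indexed by the reversed composition, see `GP-reverse`: a new head of `γ` is
  -- a new top row and leaves the other rows in place.
  Ĝ : List ℕ → Series
  Ĝ γ = LLT q (rowsR γ)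

  Ĝ-single : (c : ℕ) → Ĝ (c ∷ []) ≈ₛ h c
  Ĝ-single c μ = begin
    Ĝ (c ∷ []) μ                                                              ≡⟨ LLT-weight (rowsR (c ∷ [])) μ refl ⟩
    ∑ (tuples N (rowsR (c ∷ []))) (λ Ts → weight N Ts μ)                      ≡⟨ ∑-tuples N 0 c [] _ ⟩
    ∑ (weakIncr c 1 N) (λ u → ∑ ([] ∷ []) (λ Ts → weight N (cells 0 u ∷ Ts) μ)) ≡⟨ ∑-cong (weakIncr c 1 N) step ⟩
    ∑ (weakIncr c 1 N) (λ u → monomial (counts 1 N u) μ)                      ≡⟨ h-weakIncr μ c 1 N refl ⟩
    h c μ                                                                     ∎
    where
    N = length μ
    step : ∀ u → 1ℚ * monomial (counts 1 N (entries (cells 0 u ∷ []))) μ + 0ℚ ≡ monomial (counts 1 N u) μ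
    step u = trans (+-identityʳ _) (trans (*-identityˡ _)
      (cong (λ x → monomial (counts 1 N x) μ) (trans (entries-cells 0 u []) (++-identityʳ u))))

  -- A word of length d + c that increases weakly is a pair of weakly increasing words of lengths d and c
  -- without a descent in between, and a descent in between costs a factor q.
  Ĝ-merge : (c d : ℕ) (γ : List ℕ) → 0 < d →
            (q ⋆ (h c ⊛ Ĝ (d ∷ γ))) ≈ₛ (Ĝ (c ∷ d ∷ γ) ⊕ ((q - 1ℚ) ⋆ Ĝ (d ℕ.+ c ∷ γ)))
  Ĝ-merge c d γ 0<d μ = begin
    q * (h c ⊛ Ĝ (d ∷ γ)) μ                                          ≡⟨ cong (q *_) product ⟩
    q * ∑ W₁ (λ u → ∑ W₂ (λ v → X u v))                              ≡⟨ ∑-*ˡ W₁ q _ ⟨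
    ∑ W₁ (λ u → q * ∑ W₂ (X u))                                      ≡⟨ ∑-cong W₁ (λ u → sym (∑-*ˡ W₂ q (X u))) ⟩
    ∑ W₁ (λ u → ∑ W₂ (λ v → q * X u v))                              ≡⟨ ∑-cong W₁ (λ u → ∑-cong W₂ (λ v → balance (descent u v) (X u v))) ⟩
    ∑ W₁ (λ u → ∑ W₂ (λ v → A u v + (q - 1ℚ) * B u v))               ≡⟨ ∑-cong W₁ (λ u → trans (∑-+ W₂ (A u) _) (cong (∑ W₂ (A u) +_) (∑-*ˡ W₂ (q - 1ℚ) (B u)))) ⟩
    ∑ W₁ (λ u → ∑ W₂ (A u) + (q - 1ℚ) * ∑ W₂ (B u))                  ≡⟨ trans (∑-+ W₁ _ _) (cong (∑ W₁ (λ u → ∑ W₂ (A u)) +_) (∑-*ˡ W₁ (q - 1ℚ) _)) ⟩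
    ∑ W₁ (λ u → ∑ W₂ (A u)) + (q - 1ℚ) * ∑ W₁ (λ u → ∑ W₂ (B u))     ≡⟨ cong₂ (λ a b → a + (q - 1ℚ) * b) (sym concatenated) (sym merged) ⟩
    Ĝ (c ∷ d ∷ γ) μ + (q - 1ℚ) * Ĝ (d ℕ.+ c ∷ γ) μ                   ∎
    where
    N  = length μ
    t  = sumℕ γ
    W₁ = weakIncr c 1 N
    W₂ = weakIncr d 1 N
    Us = tuples N (rowsR γ)
    -- The word `u` is the upper row and follows `v`. The default 1 is the lower bound from which
    -- `∑-weakIncr-++` starts.
    descent : List ℕ → List ℕ → Bool
    descent u v = startsBelow (lastOr 1 v) u
    -- The summand common to the product, the concatenation and the merged row: a possible inversion
    -- at the cut between `v` and `u` is left out.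
    Y : List ℕ → List ℕ → List FilledRow → ℚ
    Y u v U = q ^ℚ inv (cells t v ∷ U) * monomial (counts 1 N (u ++ v ++ entries U)) μ
    X A B : List ℕ → List ℕ → ℚ
    X u v = ∑ Us (Y u v)
    A u v = (if descent u v then q else 1ℚ) * X u v
    B u v = if descent u v then 0ℚ else X u v

    -- With a descent only the concatenation contributes, with factor q; without one it contributes
    -- 1 and the merged row q - 1.
    balance : (b : Bool) (x : ℚ) → q * x ≡ (if b then q else 1ℚ) * x + (q - 1ℚ) * (if b then 0ℚ else x)
    balance true  x = solve 2 (λ q x → q :* x := q :* x :+ (q :- con 1ℚ) :* con 0ℚ) refl q x
    balance false x = solve 2 (λ q x → q :* x := con 1ℚ :* x :+ (q :- con 1ℚ) :* x) refl q x

    0<length : ∀ v → length v ≡ d → 0 < length v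
    0<length v e = ℕ.<-≤-trans 0<d (ℕ.≤-reflexive (sym e))

    product : (h c ⊛ Ĝ (d ∷ γ)) μ ≡ ∑ W₁ (λ u → ∑ W₂ (λ v → X u v))
    product = begin
      (h c ⊛ Ĝ (d ∷ γ)) μ
        ≡⟨ ⊛-cong-length μ (λ ν e → sym (trans (cong (λ n → ∑ (weakIncr c 1 n) (λ u → monomial (counts 1 n u) ν)) (sym e)) (h-weakIncr ν c 1 (length ν) refl)))
             (λ ν e → trans (LLT-weight (rowsR (d ∷ γ)) ν e) (∑-tuples N t d (rowsR γ) (λ Ts → weight N Ts ν))) ⟩
      ((λ ν → ∑ W₁ (λ u → monomial (counts 1 N u) ν)) ⊛ (λ ν → ∑ W₂ (λ v → ∑ Us (λ U → weight N (cells t v ∷ U) ν)))) μ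
        ≡⟨ ⊛-∑ˡ W₁ (λ u → monomial (counts 1 N u)) (λ ν → ∑ W₂ (λ v → ∑ Us (λ U → weight N (cells t v ∷ U) ν))) μ ⟩
      ∑ W₁ (λ u → (monomial (counts 1 N u) ⊛ (λ ν → ∑ W₂ (λ v → ∑ Us (λ U → weight N (cells t v ∷ U) ν)))) μ)
        ≡⟨ ∑-cong W₁ (λ u → trans (⊛-∑ʳ (monomial (counts 1 N u)) W₂ (λ v ν → ∑ Us (λ U → weight N (cells t v ∷ U) ν)) μ)
             (∑-cong W₂ (λ v → trans (⊛-∑ʳ (monomial (counts 1 N u)) Us (λ U → weight N (cells t v ∷ U)) μ)
               (∑-cong Us (λ U → term u v U))))) ⟩
      ∑ W₁ (λ u → ∑ W₂ (λ v → X u v)) ∎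
      where
      term : ∀ u v U → (monomial (counts 1 N u) ⊛ weight N (cells t v ∷ U)) μ ≡ Y u v U
      term u v U = trans (⊛-⋆ʳ (q ^ℚ inv (cells t v ∷ U)) (monomial (counts 1 N u)) (monomial (counts 1 N (entries (cells t v ∷ U)))) μ)
        (cong (q ^ℚ inv (cells t v ∷ U) *_) (trans
          (monomial-⊛ (counts 1 N u) _ μ (length-counts 1 N u) (length-counts 1 N (entries (cells t v ∷ U))))
          (cong (λ x → monomial x μ) (trans (sym (counts-++ 1 N u (entries (cells t v ∷ U))))
            (cong (λ x → counts 1 N (u ++ x)) (entries-cells t v U))))))

    concatenated : Ĝ (c ∷ d ∷ γ) μ ≡ ∑ W₁ (λ u → ∑ W₂ (A u))
    concatenated = begin
      Ĝ (c ∷ d ∷ γ) μ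
        ≡⟨ LLT-weight (rowsR (c ∷ d ∷ γ)) μ refl ⟩
      ∑ (tuples N (rowsR (c ∷ d ∷ γ))) (λ Ts → weight N Ts μ)
        ≡⟨ ∑-tuples N (d ℕ.+ t) c (rowsR (d ∷ γ)) (λ Ts → weight N Ts μ) ⟩
      ∑ W₁ (λ u → ∑ (tuples N (rowsR (d ∷ γ))) (λ Ts → weight N (cells (d ℕ.+ t) u ∷ Ts) μ))
        ≡⟨ ∑-cong W₁ (λ u → ∑-tuples N t d (rowsR γ) (λ Ts → weight N (cells (d ℕ.+ t) u ∷ Ts) μ)) ⟩
      ∑ W₁ (λ u → ∑ W₂ (λ v → ∑ Us (λ U → weight N (cells (d ℕ.+ t) u ∷ cells t v ∷ U) μ)))
        ≡⟨ ∑-cong W₁ (λ u → ∑-congᴬ (All.map (λ {v} e →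
             trans (∑-congᴬ (All.map (term u v e) (tuples-below N γ))) (∑-*ˡ Us (if descent u v then q else 1ℚ) (Y u v)))
             (weakIncr-length d 1 N))) ⟩
      ∑ W₁ (λ u → ∑ W₂ (A u)) ∎
      where
      power : (b : Bool) (k : ℕ) → q ^ℚ ((if b then 1 else 0) ℕ.+ k) ≡ (if b then q else 1ℚ) * q ^ℚ k
      power true  k = refl
      power false k = sym (*-identityˡ (q ^ℚ k))
      term : ∀ u v → length v ≡ d → {U : List FilledRow} → All (All (λ x → proj₁ x < t)) U →
             weight N (cells (d ℕ.+ t) u ∷ cells t v ∷ U) μ ≡ (if descent u v then q else 1ℚ) * Y u v U
      term u v e {U} ps = begin
        weight N (cells (d ℕ.+ t) u ∷ cells t v ∷ U) μ
          ≡⟨ cong (λ s → weight N (cells s u ∷ cells t v ∷ U) μ) (trans (ℕ.+-comm d t) (cong (t ℕ.+_) (sym e))) ⟩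
        weight N (cells (t ℕ.+ length v) u ∷ cells t v ∷ U) μ
          ≡⟨ cong₂ (λ i x → q ^ℚ i * monomial (counts 1 N x) μ) (inv-adjacent t 1 u v U (0<length v e) ps)
               (trans (entries-cells (t ℕ.+ length v) u (cells t v ∷ U)) (cong (u ++_) (entries-cells t v U))) ⟩
        q ^ℚ ((if descent u v then 1 else 0) ℕ.+ inv (cells t v ∷ U)) * monomial (counts 1 N (u ++ v ++ entries U)) μ
          ≡⟨ cong (_* monomial (counts 1 N (u ++ v ++ entries U)) μ) (power (descent u v) (inv (cells t v ∷ U))) ⟩
        (if descent u v then q else 1ℚ) * q ^ℚ inv (cells t v ∷ U) * monomial (counts 1 N (u ++ v ++ entries U)) μ
          ≡⟨ *-assoc (if descent u v then q else 1ℚ) (q ^ℚ inv (cells t v ∷ U)) _ ⟩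
        (if descent u v then q else 1ℚ) * Y u v U ∎

    merged : Ĝ (d ℕ.+ c ∷ γ) μ ≡ ∑ W₁ (λ u → ∑ W₂ (B u))
    merged = begin
      Ĝ (d ℕ.+ c ∷ γ) μ
        ≡⟨ LLT-weight (rowsR (d ℕ.+ c ∷ γ)) μ refl ⟩
      ∑ (tuples N (rowsR (d ℕ.+ c ∷ γ))) (λ Ts → weight N Ts μ)
        ≡⟨ ∑-tuples N t (d ℕ.+ c) (rowsR γ) (λ Ts → weight N Ts μ) ⟩
      ∑ (weakIncr (d ℕ.+ c) 1 N) Z
        ≡⟨ ∑-weakIncr-++ d c 1 N Z ⟩
      ∑ W₂ (λ v → ∑ (weakIncr c (lastOr 1 v) N) (λ u → Z (v ++ u)))
        ≡⟨ ∑-congᴬ (All.map (λ {v} ps → ∑-weakIncr-from c N (lastOr-≥ ℕ.≤-refl ps) (λ u → Z (v ++ u))) (weakIncr-≥ d 1 N)) ⟩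
      ∑ W₂ (λ v → ∑ W₁ (λ u → if descent u v then 0ℚ else Z (v ++ u)))
        ≡⟨ ∑-congᴬ (All.map (λ {v} e → ∑-cong W₁ (λ u → cong (if descent u v then 0ℚ else_) (term u v e))) (weakIncr-length d 1 N)) ⟩
      ∑ W₂ (λ v → ∑ W₁ (λ u → B u v))
        ≡⟨ ∑-swap W₂ W₁ (λ v u → B u v) ⟩
      ∑ W₁ (λ u → ∑ W₂ (B u)) ∎
      where
      Z : List ℕ → ℚ
      Z w = ∑ Us (λ U → weight N (cells t w ∷ U) μ)
      count-swap : ∀ (u v w : List ℕ) i → count i ((v ++ u) ++ w) ≡ count i (u ++ v ++ w)
      count-swap u v w i = begin
        count i ((v ++ u) ++ w)                         ≡⟨ trans (count-++ i (v ++ u) w) (cong (ℕ._+ count i w) (count-++ i v u)) ⟩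
        count i v ℕ.+ count i u ℕ.+ count i w           ≡⟨ cong (ℕ._+ count i w) (ℕ.+-comm (count i v) (count i u)) ⟩
        count i u ℕ.+ count i v ℕ.+ count i w           ≡⟨ ℕ.+-assoc (count i u) _ _ ⟩
        count i u ℕ.+ (count i v ℕ.+ count i w)         ≡⟨ trans (count-++ i u (v ++ w)) (cong (count i u ℕ.+_) (count-++ i v w)) ⟨
        count i (u ++ v ++ w)                           ∎
      term : ∀ u v → length v ≡ d → Z (v ++ u) ≡ X u v
      term u v e = ∑-congᴬ (All.map (λ {U} ps → cong₂ (λ i x → q ^ℚ i * monomial x μ)
        (inv-merged t u v U (0<length v e) ps)
        (trans (cong (counts 1 N) (entries-cells t (v ++ u) U)) (counts-cong (count-swap u v (entries U)) 1 N)))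
        (tuples-below N γ))

-- Product rule and expansions

·≡++ : (α β : List ℕ) → α · β ≡ α ++ β
·≡++ []      β = refl
·≡++ (a ∷ α) β = cong (a ∷_) (·≡++ α β)

reverse-· : (α β : List ℕ) → reverse (α · β) ≡ reverse β · reverse α
reverse-· α β = begin
  reverse (α · β)         ≡⟨ cong reverse (·≡++ α β) ⟩
  reverse (α ++ β)        ≡⟨ reverse-++ α β ⟩
  reverse β ++ reverse α  ≡⟨ ·≡++ (reverse β) (reverse α) ⟨
  reverse β · reverse α   ∎

snoc-⊙-∷ : (α : List ℕ) (a b : ℕ) (β : List ℕ) → (α ++ a ∷ []) ⊙ (b ∷ β) ≡ α ++ (a ℕ.+ b) ∷ β
snoc-⊙-∷ []           a b β = refl
snoc-⊙-∷ (x ∷ [])     a b β = refl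
snoc-⊙-∷ (x ∷ y ∷ α)  a b β = cong (x ∷_) (snoc-⊙-∷ (y ∷ α) a b β)

⊙-++ : (α β γ : List ℕ) → 0 < length β → (α ⊙ β) ++ γ ≡ α ⊙ (β ++ γ)
⊙-++ []          β       γ _ = refl
⊙-++ (a ∷ [])    (b ∷ β) γ _ = refl
⊙-++ (a ∷ b ∷ α) β       γ p = cong (a ∷_) (⊙-++ (b ∷ α) β γ p)

reverse-⊙ : (α β : List ℕ) → 0 < length α → 0 < length β → reverse (α ⊙ β) ≡ reverse β ⊙ reverse α
reverse-⊙ (a ∷ [])     (b ∷ β) _ _ = begin
  reverse ((a ℕ.+ b) ∷ β)            ≡⟨ unfold-reverse (a ℕ.+ b) β ⟩
  reverse β ++ (a ℕ.+ b) ∷ []        ≡⟨ cong (λ s → reverse β ++ s ∷ []) (ℕ.+-comm a b) ⟩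
  reverse β ++ (b ℕ.+ a) ∷ []        ≡⟨ snoc-⊙-∷ (reverse β) b a [] ⟨
  (reverse β ++ b ∷ []) ⊙ (a ∷ [])   ≡⟨ cong (_⊙ (a ∷ [])) (unfold-reverse b β) ⟨
  reverse (b ∷ β) ⊙ (a ∷ [])         ∎
reverse-⊙ (a ∷ a′ ∷ α) β _ p = begin
  reverse (a ∷ ((a′ ∷ α) ⊙ β))                 ≡⟨ unfold-reverse a ((a′ ∷ α) ⊙ β) ⟩
  reverse ((a′ ∷ α) ⊙ β) ++ a ∷ []             ≡⟨ cong (_++ a ∷ []) (reverse-⊙ (a′ ∷ α) β (s≤s z≤n) p) ⟩
  (reverse β ⊙ reverse (a′ ∷ α)) ++ a ∷ []     ≡⟨ ⊙-++ (reverse β) (reverse (a′ ∷ α)) (a ∷ [])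
                                                    (ℕ.<-≤-trans (s≤s z≤n) (ℕ.≤-reflexive (sym (length-reverse (a′ ∷ α))))) ⟩
  reverse β ⊙ (reverse (a′ ∷ α) ++ a ∷ [])     ≡⟨ cong (reverse β ⊙_) (unfold-reverse a (a′ ∷ α)) ⟨
  reverse β ⊙ reverse (a ∷ a′ ∷ α)             ∎

IsComposition-reverse : {α : List ℕ} → IsComposition α → IsComposition (reverse α)
IsComposition-reverse {α} (p , ps) = ℕ.<-≤-trans p (ℕ.≤-reflexive (sym (length-reverse α))) , All-resp-↭ (↭-sym (↭-reverse α)) ps

sumS-map : {A : Set} (f : A → Series) (xs : List A) → sumS (map f xs) ≈ₛ (λ μ → ∑ xs (λ x → f x μ))
sumS-map f []       μ = refl
sumS-map f (x ∷ xs) μ = cong (f x μ +_) (sumS-map f xs μ)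

prodS-cong : {f g : ℕ → Series} → (∀ a → f a ≈ₛ g a) → ∀ α → prodS (map f α) ≈ₛ prodS (map g α)
prodS-cong e []      μ = refl
prodS-cong e (a ∷ α) μ = ⊛-cong (e a) (prodS-cong e α) μ

addHead-+ : (a b : ℕ) (γ : List ℕ) → addHead a (addHead b γ) ≡ addHead (a ℕ.+ b) γ
addHead-+ a b []      = refl
addHead-+ a b (c ∷ γ) = cong (_∷ γ) (sym (ℕ.+-assoc a b c))

-- Thanks to this, the expansion of the path with first part `a + b` is again a sum over the
-- coarsenings of `b ∷ r` and can be combined termwise with that of `b ∷ r`.
coarsenings-addHead : (a b : ℕ) (r : List ℕ) → coarsenings ((a ℕ.+ b) ∷ r) ≡ map (addHead a) (coarsenings (b ∷ r))
coarsenings-addHead a b []      = refl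
coarsenings-addHead a b (c ∷ r) = sym (trans
  (map-concatMap (addHead a) (λ γ → (b ∷ γ) ∷ addHead b γ ∷ []) (coarsenings (c ∷ r)))
  (concatMap-cong (λ γ → cong (λ x → ((a ℕ.+ b) ∷ γ) ∷ x ∷ []) (addHead-+ a b γ)) (coarsenings (c ∷ r))))

∑-coarsenings : (a b : ℕ) (r : List ℕ) (f : List ℕ → ℚ) →
  ∑ (coarsenings (a ∷ b ∷ r)) f ≡ ∑ (coarsenings (b ∷ r)) (λ γ → f (a ∷ γ) + f (addHead a γ))
∑-coarsenings a b r f = trans (∑-concatMap (λ γ → (a ∷ γ) ∷ addHead a γ ∷ []) (coarsenings (b ∷ r)) f)
  (∑-cong (coarsenings (b ∷ r)) (λ γ → cong (f (a ∷ γ) +_) (+-identityʳ (f (addHead a γ)))))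

-- Not the coarsening relation itself but two consequences of it: positive parts, and a length for
-- which the truncated subtraction in the exponents is a true difference.
CoarseningOf : List ℕ → List ℕ → Set
CoarseningOf α γ = IsComposition γ × length γ ≤ length α

coarsenings-bounded : (a : ℕ) (r : List ℕ) → All (0 <_) (a ∷ r) → All (CoarseningOf (a ∷ r)) (coarsenings (a ∷ r))
coarsenings-bounded a []      ps       = ((s≤s z≤n , ps) , ℕ.≤-refl) ∷ []
coarsenings-bounded a (b ∷ r) (p ∷ ps) = All-concatMap _ (coarsenings (b ∷ r)) (All.map step (coarsenings-bounded b r ps))
  where
  step : ∀ {γ} → CoarseningOf (b ∷ r) γ → All (CoarseningOf (a ∷ b ∷ r)) ((a ∷ γ) ∷ addHead a γ ∷ [])
  step {c ∷ γ} ((_ , q ∷ qs) , l) = ((s≤s z≤n , p ∷ q ∷ qs) , s≤s l)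
    ∷ ((s≤s z≤n , ℕ.<-≤-trans p (ℕ.m≤m+n a c) ∷ qs) , ℕ.m≤n⇒m≤1+n l) ∷ []

∈-coarsenings : (a : ℕ) (r : List ℕ) → (a ∷ r) ∈ coarsenings (a ∷ r)
∈-coarsenings a []      = here refl
∈-coarsenings a (b ∷ r) = ∈-concatMap⁺ (λ γ → (a ∷ γ) ∷ addHead a γ ∷ []) (Any.map (λ { refl → here refl }) (∈-coarsenings b r))

hPart-insertDec : (x : ℕ) (ys : List ℕ) → hPart (insertDec x ys) ≈ₛ (h x ⊛ hPart ys)
hPart-insertDec x []       μ = refl
hPart-insertDec x (y ∷ ys) μ with y <ᵇ x
... | true  = refl
... | false = trans (⊛-congʳ (h y) (hPart-insertDec x ys) μ) (⊛-leftComm (h y) (h x) (hPart ys) μ)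

hPart-partitionOf : (α : List ℕ) → hPart (partitionOf α) ≈ₛ hPart α
hPart-partitionOf []      μ = refl
hPart-partitionOf (a ∷ α) μ = trans (hPart-insertDec a (partitionOf α) μ) (⊛-congʳ (h a) (hPart-partitionOf α) μ)

length-insertDec : (x : ℕ) (ys : List ℕ) → length (insertDec x ys) ≡ suc (length ys)
length-insertDec x []       = refl
length-insertDec x (y ∷ ys) with y <ᵇ x
... | true  = refl
... | false = cong suc (length-insertDec x ys)

length-partitionOf : (α : List ℕ) → length (partitionOf α) ≡ length α
length-partitionOf []      = refl
length-partitionOf (a ∷ α) = trans (length-insertDec a (partitionOf α)) (cong suc (length-partitionOf α))

module _ (q : ℚ) where

  -- If `γ` is empty, `⊙` adds `d` to the very part that `c` is merged into, so the two additions
  -- have to be interchanged; otherwise they happen at different ends.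
  Ĝ-merge-⊙ : (c e : ℕ) (γ : List ℕ) (d : ℕ) (δ : List ℕ) → 0 < e →
    (q ⋆ (h c ⊛ Ĝ q ((e ∷ γ) ⊙ (d ∷ δ)))) ≈ₛ (Ĝ q (c ∷ ((e ∷ γ) ⊙ (d ∷ δ))) ⊕ ((q - 1ℚ) ⋆ Ĝ q ((e ℕ.+ c ∷ γ) ⊙ (d ∷ δ))))
  Ĝ-merge-⊙ c e []      d δ 0<e μ = trans (Ĝ-merge q c (e ℕ.+ d) δ (ℕ.<-≤-trans 0<e (ℕ.m≤m+n e d)) μ)
    (cong (λ s → Ĝ q (c ∷ e ℕ.+ d ∷ δ) μ + (q - 1ℚ) * Ĝ q (s ∷ δ) μ)
      (trans (ℕ.+-assoc e d c) (trans (cong (e ℕ.+_) (ℕ.+-comm d c)) (sym (ℕ.+-assoc e c d)))))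
  Ĝ-merge-⊙ c e (f ∷ γ) d δ 0<e μ = Ĝ-merge q c e ((f ∷ γ) ⊙ (d ∷ δ)) 0<e μ

  -- Induction on the length of the first list: `Ĝ-merge` expresses its polynomial through those of
  -- two lists with one part fewer. When `c` is merged back, the terms `z₁` and `z₂` with the merged
  -- head cancel, as they occur with the opposite factors q - 1 and 1 - q.
  Ĝ-product : (c : ℕ) (γ : List ℕ) (d : ℕ) (δ : List ℕ) → All (0 <_) (c ∷ γ) → 0 < d →
    (q ⋆ (Ĝ q (c ∷ γ) ⊛ Ĝ q (d ∷ δ))) ≈ₛ (Ĝ q ((c ∷ γ) · (d ∷ δ)) ⊕ ((q - 1ℚ) ⋆ Ĝ q ((c ∷ γ) ⊙ (d ∷ δ))))
  Ĝ-product c []      d δ _ 0<d μ = begin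
    q * (Ĝ q (c ∷ []) ⊛ Ĝ q (d ∷ δ)) μ                     ≡⟨ cong (q *_) (⊛-congˡ (Ĝ q (d ∷ δ)) (Ĝ-single q c) μ) ⟩
    q * (h c ⊛ Ĝ q (d ∷ δ)) μ                              ≡⟨ Ĝ-merge q c d δ 0<d μ ⟩
    Ĝ q (c ∷ d ∷ δ) μ + (q - 1ℚ) * Ĝ q (d ℕ.+ c ∷ δ) μ     ≡⟨ cong (λ s → Ĝ q (c ∷ d ∷ δ) μ + (q - 1ℚ) * Ĝ q (s ∷ δ) μ) (ℕ.+-comm d c) ⟩
    Ĝ q (c ∷ d ∷ δ) μ + (q - 1ℚ) * Ĝ q (c ℕ.+ d ∷ δ) μ     ∎
  Ĝ-product c (e ∷ γ) d δ (0<c ∷ 0<e ∷ 0<γ) 0<d μ = begin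
    q * (Ĝ q (c ∷ e ∷ γ) ⊛ P) μ
      ≡⟨ cong (q *_) (⊛-congˡ P unmerge μ) ⟩
    q * (((q ⋆ (h c ⊛ E)) ⊕ ((1ℚ - q) ⋆ M)) ⊛ P) μ
      ≡⟨ cong (q *_) (trans (⊛-distribʳ-⊕ (q ⋆ (h c ⊛ E)) ((1ℚ - q) ⋆ M) P μ)
           (cong₂ _+_ (trans (⊛-⋆ˡ q (h c ⊛ E) P μ) (cong (q *_) (⊛-assoc (h c) E P μ))) (⊛-⋆ˡ (1ℚ - q) M P μ))) ⟩
    q * (q * (h c ⊛ (E ⊛ P)) μ + (1ℚ - q) * (M ⊛ P) μ)
      -- The inner factor q is spent on the induction hypothesis for `E ⊛ P`; the outer one remains
      -- for putting `c` back in front.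
      ≡⟨ cong (λ x → q * (x + (1ℚ - q) * (M ⊛ P) μ)) (begin
           q * (h c ⊛ (E ⊛ P)) μ                         ≡⟨ ⊛-⋆ʳ q (h c) (E ⊛ P) μ ⟨
           (h c ⊛ (q ⋆ (E ⊛ P))) μ                       ≡⟨ ⊛-congʳ (h c) (Ĝ-product e γ d δ (0<e ∷ 0<γ) 0<d) μ ⟩
           (h c ⊛ (E₁ ⊕ ((q - 1ℚ) ⋆ E₂))) μ              ≡⟨ ⊛-distribˡ-⊕ (h c) E₁ ((q - 1ℚ) ⋆ E₂) μ ⟩
           (h c ⊛ E₁) μ + (h c ⊛ ((q - 1ℚ) ⋆ E₂)) μ      ≡⟨ cong ((h c ⊛ E₁) μ +_) (⊛-⋆ʳ (q - 1ℚ) (h c) E₂ μ) ⟩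
           (h c ⊛ E₁) μ + (q - 1ℚ) * (h c ⊛ E₂) μ        ∎) ⟩
    q * ((h c ⊛ E₁) μ + (q - 1ℚ) * (h c ⊛ E₂) μ + (1ℚ - q) * (M ⊛ P) μ)
      ≡⟨ solve 4 (λ q x y z → q :* (x :+ (q :- con 1ℚ) :* y :+ (con 1ℚ :- q) :* z)
                            := q :* x :+ (q :- con 1ℚ) :* (q :* y) :+ (con 1ℚ :- q) :* (q :* z)) refl
           q ((h c ⊛ E₁) μ) ((h c ⊛ E₂) μ) ((M ⊛ P) μ) ⟩
    q * (h c ⊛ E₁) μ + (q - 1ℚ) * (q * (h c ⊛ E₂) μ) + (1ℚ - q) * (q * (M ⊛ P) μ)
      ≡⟨ cong₂ _+_ (cong₂ (λ x y → x + (q - 1ℚ) * y) (Ĝ-merge q c e (γ · (d ∷ δ)) 0<e μ) (Ĝ-merge-⊙ c e γ d δ 0<e μ))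
                   (cong ((1ℚ - q) *_) (Ĝ-product (e ℕ.+ c) γ d δ (ℕ.<-≤-trans 0<e (ℕ.m≤m+n e c) ∷ 0<γ) 0<d μ)) ⟩
    (x₁ + (q - 1ℚ) * z₁) + (q - 1ℚ) * (x₂ + (q - 1ℚ) * z₂) + (1ℚ - q) * (z₁ + (q - 1ℚ) * z₂)
      ≡⟨ solve 5 (λ q x₁ x₂ z₁ z₂ → (x₁ :+ (q :- con 1ℚ) :* z₁) :+ (q :- con 1ℚ) :* (x₂ :+ (q :- con 1ℚ) :* z₂)
                                      :+ (con 1ℚ :- q) :* (z₁ :+ (q :- con 1ℚ) :* z₂)
                                  := x₁ :+ (q :- con 1ℚ) :* x₂) refl q x₁ x₂ z₁ z₂ ⟩
    x₁ + (q - 1ℚ) * x₂ ∎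
    where
    P  = Ĝ q (d ∷ δ)
    E  = Ĝ q (e ∷ γ)
    M  = Ĝ q (e ℕ.+ c ∷ γ)
    E₁ = Ĝ q ((e ∷ γ) · (d ∷ δ))
    E₂ = Ĝ q ((e ∷ γ) ⊙ (d ∷ δ))
    x₁ = Ĝ q ((c ∷ e ∷ γ) · (d ∷ δ)) μ
    x₂ = Ĝ q ((c ∷ e ∷ γ) ⊙ (d ∷ δ)) μ
    z₁ = Ĝ q ((e ℕ.+ c ∷ γ) · (d ∷ δ)) μ
    z₂ = Ĝ q ((e ℕ.+ c ∷ γ) ⊙ (d ∷ δ)) μ
    unmerge : Ĝ q (c ∷ e ∷ γ) ≈ₛ ((q ⋆ (h c ⊛ E)) ⊕ ((1ℚ - q) ⋆ M))
    unmerge ν = begin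
      Ĝ q (c ∷ e ∷ γ) ν
        ≡⟨ solve 3 (λ q x y → x := (x :+ (q :- con 1ℚ) :* y) :+ (con 1ℚ :- q) :* y) refl q (Ĝ q (c ∷ e ∷ γ) ν) (M ν) ⟩
      Ĝ q (c ∷ e ∷ γ) ν + (q - 1ℚ) * M ν + (1ℚ - q) * M ν
        ≡⟨ cong (_+ (1ℚ - q) * M ν) (Ĝ-merge q c e γ 0<e ν) ⟨
      q * (h c ⊛ E) ν + (1ℚ - q) * M ν ∎

  GP-reverse : (α : List ℕ) → GP q α ≡ Ĝ q (reverse α)
  GP-reverse α = cong (LLT q) (pathRows-reverse α)

  Ĝ-product′ : (γ δ : List ℕ) → IsComposition γ → IsComposition δ →
    (q ⋆ (Ĝ q γ ⊛ Ĝ q δ)) ≈ₛ (Ĝ q (γ · δ) ⊕ ((q - 1ℚ) ⋆ Ĝ q (γ ⊙ δ)))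
  Ĝ-product′ (c ∷ γ) (d ∷ δ) (_ , ps) (_ , 0<d ∷ _) = Ĝ-product c γ d δ ps 0<d

  GP-product : (α β : List ℕ) → IsComposition α → IsComposition β →
    (q ⋆ (GP q α ⊛ GP q β)) ≈ₛ (GP q (α · β) ⊕ ((q - 1ℚ) ⋆ GP q (α ⊙ β)))
  GP-product α β cα cβ μ = begin
    q * (GP q α ⊛ GP q β) μ
      ≡⟨ cong₂ (λ F G → q * (F ⊛ G) μ) (GP-reverse α) (GP-reverse β) ⟩
    q * (Ĝ q (reverse α) ⊛ Ĝ q (reverse β)) μ
      ≡⟨ cong (q *_) (⊛-comm (Ĝ q (reverse α)) (Ĝ q (reverse β)) μ) ⟩
    q * (Ĝ q (reverse β) ⊛ Ĝ q (reverse α)) μ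
      ≡⟨ Ĝ-product′ (reverse β) (reverse α) (IsComposition-reverse cβ) (IsComposition-reverse cα) μ ⟩
    Ĝ q (reverse β · reverse α) μ + (q - 1ℚ) * Ĝ q (reverse β ⊙ reverse α) μ
      ≡⟨ cong₂ (λ F G → F μ + (q - 1ℚ) * G μ)
           (trans (GP-reverse (α · β)) (cong (Ĝ q) (reverse-· α β)))
           (trans (GP-reverse (α ⊙ β)) (cong (Ĝ q) (reverse-⊙ α β (proj₁ cα) (proj₁ cβ)))) ⟨
    GP q (α · β) μ + (q - 1ℚ) * GP q (α ⊙ β) μ ∎

  GP-single : (a : ℕ) → GP q (a ∷ []) ≈ₛ h a
  GP-single = Ĝ-single q

  h⊛GP : (a : ℕ) (γ : List ℕ) → 0 < a → IsComposition γ →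
    (q ⋆ (h a ⊛ GP q γ)) ≈ₛ (GP q (a ∷ γ) ⊕ ((q - 1ℚ) ⋆ GP q (addHead a γ)))
  h⊛GP a (c ∷ γ) 0<a cγ μ = trans (cong (q *_) (sym (⊛-congˡ (GP q (c ∷ γ)) (GP-single a) μ)))
    (GP-product (a ∷ []) (c ∷ γ) (s≤s z≤n , 0<a ∷ []) cγ μ)

  -- Solving `h⊛GP` for the longer path moves the near-concatenation to the other side and turns q -
  -- 1 into 1 - q. Splitting off `a` thus costs q if `a` stays a part of its own and 1 - q if it is
  -- merged with its neighbour.
  GP-expansion : (a : ℕ) (r : List ℕ) → All (0 <_) (a ∷ r) → GP q (a ∷ r) ≈ₛ
    (λ μ → ∑ (coarsenings (a ∷ r)) (λ γ → ((q ^ℚ (length γ ∸ 1)) * ((1ℚ - q) ^ℚ (length (a ∷ r) ∸ length γ))) * hPart γ μ))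
  GP-expansion a []      _        μ = begin
    GP q (a ∷ []) μ                      ≡⟨ GP-single a μ ⟩
    h a μ                                ≡⟨ trans (⊛-comm (h a) oneS μ) (⊛-identityˡ (h a) μ) ⟨
    hPart (a ∷ []) μ                     ≡⟨ trans (+-identityʳ _) (*-identityˡ (hPart (a ∷ []) μ)) ⟨
    1ℚ * hPart (a ∷ []) μ + 0ℚ           ∎
  GP-expansion a (b ∷ r) (0<a ∷ 0<b ∷ ps) μ = begin
    GP q (a ∷ b ∷ r) μ
      ≡⟨ solve 3 (λ q x y → x := (x :+ (q :- con 1ℚ) :* y) :+ (con 1ℚ :- q) :* y) refl q (GP q (a ∷ b ∷ r) μ) (GP q (a ℕ.+ b ∷ r) μ) ⟩
    (GP q (a ∷ b ∷ r) μ + (q - 1ℚ) * GP q (a ℕ.+ b ∷ r) μ) + (1ℚ - q) * GP q (a ℕ.+ b ∷ r) μ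
      ≡⟨ cong₂ (λ x y → x + (1ℚ - q) * y) (sym (h⊛GP a (b ∷ r) 0<a (s≤s z≤n , 0<b ∷ ps) μ)) mergedHead ⟩
    q * (h a ⊛ GP q (b ∷ r)) μ + (1ℚ - q) * ∑ C (λ γ → coeff ℓ γ * hPart (addHead a γ) μ)
      ≡⟨ cong (λ x → q * x + (1ℚ - q) * ∑ C (λ γ → coeff ℓ γ * hPart (addHead a γ) μ)) newHead ⟩
    q * ∑ C (λ γ → coeff ℓ γ * hPart (a ∷ γ) μ) + (1ℚ - q) * ∑ C (λ γ → coeff ℓ γ * hPart (addHead a γ) μ)
      ≡⟨ cong₂ _+_ (∑-*ˡ C q _) (∑-*ˡ C (1ℚ - q) _) ⟨
    ∑ C (λ γ → q * (coeff ℓ γ * hPart (a ∷ γ) μ)) + ∑ C (λ γ → (1ℚ - q) * (coeff ℓ γ * hPart (addHead a γ) μ))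
      ≡⟨ ∑-+ C _ _ ⟨
    ∑ C (λ γ → q * (coeff ℓ γ * hPart (a ∷ γ) μ) + (1ℚ - q) * (coeff ℓ γ * hPart (addHead a γ) μ))
      ≡⟨ ∑-congᴬ (All.map (λ {γ} → coeffs {γ}) (coarsenings-bounded b r (0<b ∷ ps))) ⟩
    ∑ C (λ γ → coeff (suc ℓ) (a ∷ γ) * hPart (a ∷ γ) μ + coeff (suc ℓ) (addHead a γ) * hPart (addHead a γ) μ)
      ≡⟨ ∑-coarsenings a b r (λ γ → coeff (suc ℓ) γ * hPart γ μ) ⟨
    ∑ (coarsenings (a ∷ b ∷ r)) (λ γ → coeff (suc ℓ) γ * hPart γ μ) ∎
    where
    C = coarsenings (b ∷ r)
    ℓ = length (b ∷ r)
    coeff : ℕ → List ℕ → ℚ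
    coeff l γ = (q ^ℚ (length γ ∸ 1)) * ((1ℚ - q) ^ℚ (l ∸ length γ))

    newHead : (h a ⊛ GP q (b ∷ r)) μ ≡ ∑ C (λ γ → coeff ℓ γ * hPart (a ∷ γ) μ)
    newHead = begin
      (h a ⊛ GP q (b ∷ r)) μ                                  ≡⟨ ⊛-congʳ (h a) (GP-expansion b r (0<b ∷ ps)) μ ⟩
      (h a ⊛ (λ ν → ∑ C (λ γ → coeff ℓ γ * hPart γ ν))) μ     ≡⟨ ⊛-∑ʳ (h a) C (λ γ → coeff ℓ γ ⋆ hPart γ) μ ⟩
      ∑ C (λ γ → (h a ⊛ (coeff ℓ γ ⋆ hPart γ)) μ)             ≡⟨ ∑-cong C (λ γ → ⊛-⋆ʳ (coeff ℓ γ) (h a) (hPart γ) μ) ⟩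
      ∑ C (λ γ → coeff ℓ γ * hPart (a ∷ γ) μ)                 ∎

    mergedHead : GP q (a ℕ.+ b ∷ r) μ ≡ ∑ C (λ γ → coeff ℓ γ * hPart (addHead a γ) μ)
    mergedHead = begin
      GP q (a ℕ.+ b ∷ r) μ
        ≡⟨ GP-expansion (a ℕ.+ b) r (ℕ.<-≤-trans 0<a (ℕ.m≤m+n a b) ∷ ps) μ ⟩
      ∑ (coarsenings (a ℕ.+ b ∷ r)) (λ γ → coeff ℓ γ * hPart γ μ)
        ≡⟨ cong (λ l → ∑ l (λ γ → coeff ℓ γ * hPart γ μ)) (coarsenings-addHead a b r) ⟩
      ∑ (map (addHead a) C) (λ γ → coeff ℓ γ * hPart γ μ)
        ≡⟨ ∑-map (addHead a) C (λ γ → coeff ℓ γ * hPart γ μ) ⟩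
      ∑ C (λ γ → coeff ℓ (addHead a γ) * hPart (addHead a γ) μ)
        ≡⟨ ∑-congᴬ (All.map (λ {γ} → sameLength {γ}) (coarsenings-bounded b r (0<b ∷ ps))) ⟩
      ∑ C (λ γ → coeff ℓ γ * hPart (addHead a γ) μ) ∎
      where
      sameLength : ∀ {γ} → CoarseningOf (b ∷ r) γ → coeff ℓ (addHead a γ) * hPart (addHead a γ) μ ≡ coeff ℓ γ * hPart (addHead a γ) μ
      sameLength {c ∷ γ} _ = refl

    coeffs : ∀ {γ} → CoarseningOf (b ∷ r) γ →
      q * (coeff ℓ γ * hPart (a ∷ γ) μ) + (1ℚ - q) * (coeff ℓ γ * hPart (addHead a γ) μ) ≡
      coeff (suc ℓ) (a ∷ γ) * hPart (a ∷ γ) μ + coeff (suc ℓ) (addHead a γ) * hPart (addHead a γ) μ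
    -- Since `γ` is no longer than the composition, raising the length by one raises the truncated
    -- difference by one: this is the additional factor 1 - q of the merged head.
    coeffs {c ∷ γ} (_ , l) rewrite ℕ.+-∸-assoc 1 l =
      solve 5 (λ q x y s t → q :* ((x :* y) :* s) :+ (con 1ℚ :- q) :* ((x :* y) :* t)
                          := (q :* x) :* y :* s :+ x :* ((con 1ℚ :- q) :* y) :* t) refl
        q (q ^ℚ length γ) ((1ℚ - q) ^ℚ (ℓ ∸ suc (length γ))) (hPart (a ∷ c ∷ γ) μ) (hPart (addHead a (c ∷ γ)) μ)

  module _ (q≢0 : q ≢ 0ℚ) where

    q⁻¹ : ℚ
    q⁻¹ = invℚ q q≢0

    q⁻¹*q : q⁻¹ * q ≡ 1ℚ
    q⁻¹*q = *-inverseˡ q ⦃ ≢-nonZero q≢0 ⦄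

    divide : (x y z : ℚ) → q * x ≡ y + (q - 1ℚ) * z → x ≡ q⁻¹ * y + ((q - 1ℚ) * q⁻¹) * z
    divide x y z e = begin
      x                                     ≡⟨ *-identityˡ x ⟨
      1ℚ * x                                ≡⟨ cong (_* x) q⁻¹*q ⟨
      q⁻¹ * q * x                           ≡⟨ *-assoc q⁻¹ q x ⟩
      q⁻¹ * (q * x)                         ≡⟨ cong (q⁻¹ *_) e ⟩
      q⁻¹ * (y + (q - 1ℚ) * z)              ≡⟨ solve 4 (λ i q y z → i :* (y :+ (q :- con 1ℚ) :* z) := i :* y :+ ((q :- con 1ℚ) :* i) :* z) refl q⁻¹ q y z ⟩
      q⁻¹ * y + ((q - 1ℚ) * q⁻¹) * z        ∎

    -- Each part that is split off contributes one factor `q⁻¹`, whether it is kept or merged; a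
    -- merge contributes q - 1 besides. Hence the power of `q⁻¹` is the same for all coarsenings.
    prodS-expansion : (a : ℕ) (r : List ℕ) → All (0 <_) (a ∷ r) → hPart (a ∷ r) ≈ₛ
      (λ μ → ∑ (coarsenings (a ∷ r)) (λ γ → (((q - 1ℚ) ^ℚ (length (a ∷ r) ∸ length γ)) * (q⁻¹ ^ℚ length r)) * GP q γ μ))
    prodS-expansion a []      _          μ = begin
      hPart (a ∷ []) μ                 ≡⟨ trans (⊛-comm (h a) oneS μ) (⊛-identityˡ (h a) μ) ⟩
      h a μ                            ≡⟨ GP-single a μ ⟨
      GP q (a ∷ []) μ                  ≡⟨ trans (+-identityʳ _) (*-identityˡ (GP q (a ∷ []) μ)) ⟨
      1ℚ * GP q (a ∷ []) μ + 0ℚ        ∎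
    prodS-expansion a (b ∷ r) (0<a ∷ ps) μ = begin
      (h a ⊛ hPart (b ∷ r)) μ
        ≡⟨ ⊛-congʳ (h a) (prodS-expansion b r ps) μ ⟩
      (h a ⊛ (λ ν → ∑ C (λ γ → coeff γ * GP q γ ν))) μ
        ≡⟨ ⊛-∑ʳ (h a) C (λ γ → coeff γ ⋆ GP q γ) μ ⟩
      ∑ C (λ γ → (h a ⊛ (coeff γ ⋆ GP q γ)) μ)
        ≡⟨ ∑-congᴬ (All.map (λ {γ} → step {γ}) (coarsenings-bounded b r ps)) ⟩
      ∑ C (λ γ → coeff′ (a ∷ γ) * GP q (a ∷ γ) μ + coeff′ (addHead a γ) * GP q (addHead a γ) μ)
        ≡⟨ ∑-coarsenings a b r (λ γ → coeff′ γ * GP q γ μ) ⟨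
      ∑ (coarsenings (a ∷ b ∷ r)) (λ γ → coeff′ γ * GP q γ μ) ∎
      where
      C = coarsenings (b ∷ r)
      ℓ = length (b ∷ r)
      coeff coeff′ : List ℕ → ℚ
      coeff  γ = ((q - 1ℚ) ^ℚ (ℓ ∸ length γ)) * (q⁻¹ ^ℚ length r)
      coeff′ γ = ((q - 1ℚ) ^ℚ (suc ℓ ∸ length γ)) * (q⁻¹ ^ℚ ℓ)
      step : ∀ {γ} → CoarseningOf (b ∷ r) γ → (h a ⊛ (coeff γ ⋆ GP q γ)) μ ≡
             coeff′ (a ∷ γ) * GP q (a ∷ γ) μ + coeff′ (addHead a γ) * GP q (addHead a γ) μ
      step {c ∷ γ} (cγ , l) rewrite ℕ.+-∸-assoc 1 l = begin
        (h a ⊛ (coeff (c ∷ γ) ⋆ GP q (c ∷ γ))) μ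
          ≡⟨ ⊛-⋆ʳ (coeff (c ∷ γ)) (h a) (GP q (c ∷ γ)) μ ⟩
        coeff (c ∷ γ) * (h a ⊛ GP q (c ∷ γ)) μ
          ≡⟨ cong (coeff (c ∷ γ) *_) (divide _ _ _ (h⊛GP a (c ∷ γ) 0<a cγ μ)) ⟩
        (x * y) * (q⁻¹ * s + ((q - 1ℚ) * q⁻¹) * t)
          ≡⟨ solve 6 (λ q i x y s t → (x :* y) :* (i :* s :+ ((q :- con 1ℚ) :* i) :* t)
                      := x :* (i :* y) :* s :+ (q :- con 1ℚ) :* x :* (i :* y) :* t) refl q q⁻¹ x y s t ⟩
        x * (q⁻¹ * y) * s + (q - 1ℚ) * x * (q⁻¹ * y) * t ∎
        where
        x = (q - 1ℚ) ^ℚ (ℓ ∸ length (c ∷ γ))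
        y = q⁻¹ ^ℚ length r
        s = GP q (a ∷ c ∷ γ) μ
        t = GP q (addHead a (c ∷ γ)) μ

-- Linear independence of the products of complete homogeneous functions

∑-↭ : {A : Set} {xs ys : List A} (f : A → ℚ) → xs ↭ ys → ∑ xs f ≡ ∑ ys f
∑-↭ f ↭.refl        = refl
∑-↭ f (prep x p)    = cong (f x +_) (∑-↭ f p)
∑-↭ {xs = _ ∷ _ ∷ xs} {ys = _ ∷ _ ∷ ys} f (swap x y p) = trans (cong (λ s → f x + (f y + s)) (∑-↭ f p))
  (solve 3 (λ a b c → a :+ (b :+ c) := b :+ (a :+ c)) refl (f x) (f y) (∑ ys f))
∑-↭ f (↭.trans p r) = trans (∑-↭ f p) (∑-↭ f r)

insertDec-comm : (x y : ℕ) (zs : List ℕ) → insertDec x (insertDec y zs) ≡ insertDec y (insertDec x zs)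
insertDec-comm x y [] with ℕ.<-cmp x y
... | tri< x<y _ _ rewrite <⇒<ᵇ x<y | ≥⇒≮ᵇ (ℕ.<⇒≤ x<y) = refl
... | tri≈ _ refl _ = refl
... | tri> _ _ y<x rewrite <⇒<ᵇ y<x | ≥⇒≮ᵇ (ℕ.<⇒≤ y<x) = refl
insertDec-comm x y (z ∷ zs) with z ℕ.<? x | z ℕ.<? y
... | no z≮x | no z≮y
  rewrite ≥⇒≮ᵇ (ℕ.≮⇒≥ z≮x) | ≥⇒≮ᵇ (ℕ.≮⇒≥ z≮y) | ≥⇒≮ᵇ (ℕ.≮⇒≥ z≮x) = cong (z ∷_) (insertDec-comm x y zs)
... | yes z<x | no z≮y
  rewrite <⇒<ᵇ z<x | ≥⇒≮ᵇ (ℕ.≮⇒≥ z≮y) | <⇒<ᵇ z<x | ≥⇒≮ᵇ (ℕ.≤-trans (ℕ.≮⇒≥ z≮y) (ℕ.<⇒≤ z<x)) = refl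
... | no z≮x | yes z<y
  rewrite ≥⇒≮ᵇ (ℕ.≮⇒≥ z≮x) | <⇒<ᵇ z<y | ≥⇒≮ᵇ (ℕ.≤-trans (ℕ.≮⇒≥ z≮x) (ℕ.<⇒≤ z<y)) | ≥⇒≮ᵇ (ℕ.≮⇒≥ z≮x) = refl
... | yes z<x | yes z<y with ℕ.<-cmp x y
...   | tri≈ _ refl _ = refl
...   | tri< x<y _ _ rewrite <⇒<ᵇ z<x | <⇒<ᵇ z<y | <⇒<ᵇ x<y | ≥⇒≮ᵇ (ℕ.<⇒≤ x<y) | <⇒<ᵇ z<x = refl
...   | tri> _ _ y<x rewrite <⇒<ᵇ z<x | <⇒<ᵇ z<y | <⇒<ᵇ y<x | ≥⇒≮ᵇ (ℕ.<⇒≤ y<x) = refl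

partitionOf-↭ : {α β : List ℕ} → α ↭ β → partitionOf α ≡ partitionOf β
partitionOf-↭ ↭.refl        = refl
partitionOf-↭ (prep x p)    = cong (insertDec x) (partitionOf-↭ p)
partitionOf-↭ {_ ∷ _ ∷ α} (swap x y p) =
  trans (insertDec-comm x y (partitionOf α)) (cong (insertDec y ∘ insertDec x) (partitionOf-↭ p))
partitionOf-↭ (↭.trans p r) = trans (partitionOf-↭ p) (partitionOf-↭ r)

-- Both sides count the `i` with `i + x = a` and `i + y = m`. In `hPart-∷` this `i` is the corner
-- entry of a matrix, and `x` and `y` are the sums of the rest of its column and of its row.
conv-δ-swap : (x y m a : ℕ) →
  conv (λ i j → δ x j * δ (i ℕ.+ y) m) a ≡ conv (λ i j → δ (i ℕ.+ x) a * δ y j) m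
conv-δ-swap x y zero    zero    = refl
conv-δ-swap x y (suc m) zero    = trans (+-identityʳ (δ x 0 * δ y (suc m)))
  (sym (conv-single (λ i j → δ (i ℕ.+ x) 0 * δ y j) (suc m) (λ i j → *-zeroˡ (δ y j))))
conv-δ-swap x y zero    (suc a) = trans
  (conv-single (λ i j → δ x j * δ (i ℕ.+ y) 0) (suc a) (λ i j → *-zeroʳ (δ x j)))
  (sym (+-identityʳ (δ x (suc a) * δ y 0)))
conv-δ-swap x y (suc m) (suc a) = begin
  conv (λ i j → δ x j * δ (i ℕ.+ y) (suc m)) (suc a)
    ≡⟨ conv-suc (λ i j → δ x j * δ (i ℕ.+ y) (suc m)) a ⟩
  δ x (suc a) * δ y (suc m) + conv (λ i j → δ x j * δ (i ℕ.+ y) m) a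
    ≡⟨ cong (δ x (suc a) * δ y (suc m) +_) (conv-δ-swap x y m a) ⟩
  δ x (suc a) * δ y (suc m) + conv (λ i j → δ (i ℕ.+ x) a * δ y j) m
    ≡⟨ conv-suc (λ i j → δ (i ℕ.+ x) (suc a) * δ y j) m ⟨
  conv (λ i j → δ (i ℕ.+ x) (suc a) * δ y j) (suc m) ∎

-- Both sides of hPart-sym count the matrices of natural numbers with row sums λ and column sums μ;
-- this lemma splits off a row on the column side.
hPart-∷ : (a : ℕ) (κ μ : List ℕ) → hPart μ (a ∷ κ) ≡ (h a ⊛ (λ ρ → hPart ρ κ)) μ
hPart-∷ zero    κ []      = sym (trans (+-identityʳ (1ℚ * oneS κ)) (*-identityˡ (oneS κ)))
hPart-∷ (suc a) κ []      = sym (trans (+-identityʳ (0ℚ * oneS κ)) (*-zeroˡ (oneS κ)))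
hPart-∷ a       κ (m ∷ μ) = begin
  (h m ⊛ hPart μ) (a ∷ κ)
    ≡⟨ ⊛-∷ (h m) (hPart μ) a κ ⟩
  conv (λ i j → ((h m at i) ⊛ (hPart μ at j)) κ) a
    ≡⟨ conv-cong a (λ i j → begin
         ((h m at i) ⊛ (hPart μ at j)) κ
           ≡⟨ ⊛-congʳ (h m at i) (λ κ′ → hPart-∷ j κ′ μ) κ ⟩
         ((h m at i) ⊛ (λ κ′ → ∑ N (λ ν → h j ν * hPart (μ -ᵛ ν) κ′))) κ
           ≡⟨ ⊛-∑ʳ (h m at i) N (λ ν → h j ν ⋆ hPart (μ -ᵛ ν)) κ ⟩
         ∑ N (λ ν → ((h m at i) ⊛ (h j ν ⋆ hPart (μ -ᵛ ν))) κ)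
           ≡⟨ ∑-cong N (λ ν → ∑-cong K (λ κ′ → regroup (h m (i ∷ κ′)) (h j ν) (X ν κ′))) ⟩
         ∑ N (λ ν → ∑ K (λ κ′ → h j ν * h m (i ∷ κ′) * X ν κ′)) ∎) ⟩
  conv (λ i j → ∑ N (λ ν → ∑ K (λ κ′ → h j ν * h m (i ∷ κ′) * X ν κ′))) a
    ≡⟨ collect a (λ ν κ′ i j → h j ν * h m (i ∷ κ′)) ⟩
  ∑ N (λ ν → ∑ K (λ κ′ → conv (λ i j → h j ν * h m (i ∷ κ′)) a * X ν κ′))
    ≡⟨ ∑-cong N (λ ν → ∑-cong K (λ κ′ → cong (_* X ν κ′) (conv-δ-swap (sumℕ ν) (sumℕ κ′) m a))) ⟩
  ∑ N (λ ν → ∑ K (λ κ′ → conv (λ i j → h a (i ∷ ν) * h j κ′) m * X ν κ′))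
    ≡⟨ collect m (λ ν κ′ i j → h a (i ∷ ν) * h j κ′) ⟨
  conv (λ i j → ∑ N (λ ν → ∑ K (λ κ′ → h a (i ∷ ν) * h j κ′ * X ν κ′))) m
    ≡⟨ conv-cong m (λ i j → ∑-cong N (λ ν → trans (∑-cong K (λ κ′ → *-assoc (h a (i ∷ ν)) (h j κ′) (X ν κ′)))
                                                  (∑-*ˡ K (h a (i ∷ ν)) (λ κ′ → h j κ′ * X ν κ′)))) ⟩
  conv (λ i j → ((h a at i) ⊛ ((λ ρ → hPart ρ κ) at j)) μ) m
    ≡⟨ ⊛-∷ (h a) (λ ρ → hPart ρ κ) m μ ⟨
  (h a ⊛ (λ ρ → hPart ρ κ)) (m ∷ μ) ∎
  where
  N = below μ
  K = below κ
  _-ᵛ_ : List ℕ → List ℕ → List ℕ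
  _-ᵛ_ = zipWith _∸_
  -- The number of ways to complete the matrix once the row of `m` and the column of `a` are taken
  -- away; outside the corner their entries are `κ′` and `ν`.
  X : List ℕ → List ℕ → ℚ
  X ν κ′ = hPart (μ -ᵛ ν) (κ -ᵛ κ′)
  regroup : ∀ x y z → x * (y * z) ≡ y * x * z
  regroup = solve 3 (λ x y z → x :* (y :* z) := y :* x :* z) refl
  collect : ∀ n (f : List ℕ → List ℕ → ℕ → ℕ → ℚ) →
    conv (λ i j → ∑ N (λ ν → ∑ K (λ κ′ → f ν κ′ i j * X ν κ′))) n ≡
    ∑ N (λ ν → ∑ K (λ κ′ → conv (f ν κ′) n * X ν κ′))
  collect n f = begin
    conv (λ i j → ∑ N (λ ν → ∑ K (λ κ′ → f ν κ′ i j * X ν κ′))) n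
      ≡⟨ ∑-swap (antidiagonal n) N (λ (i , j) ν → ∑ K (λ κ′ → f ν κ′ i j * X ν κ′)) ⟩
    ∑ N (λ ν → conv (λ i j → ∑ K (λ κ′ → f ν κ′ i j * X ν κ′)) n)
      ≡⟨ ∑-cong N (λ ν → ∑-swap (antidiagonal n) K (λ (i , j) κ′ → f ν κ′ i j * X ν κ′)) ⟩
    ∑ N (λ ν → ∑ K (λ κ′ → conv (λ i j → f ν κ′ i j * X ν κ′) n))
      ≡⟨ ∑-cong N (λ ν → ∑-cong K (λ κ′ → ∑-*ʳ (antidiagonal n) (X ν κ′) (uncurry (f ν κ′)))) ⟩
    ∑ N (λ ν → ∑ K (λ κ′ → conv (f ν κ′) n * X ν κ′)) ∎

hPart-[] : (μ : List ℕ) → hPart μ [] ≡ oneS μ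
hPart-[] []          = refl
hPart-[] (zero  ∷ μ) = trans (⊛-[] (h 0) (hPart μ)) (trans (*-identityˡ (hPart μ [])) (hPart-[] μ))
hPart-[] (suc m ∷ μ) = trans (⊛-[] (h (suc m)) (hPart μ)) (*-zeroˡ (hPart μ []))

hPart-sym : (κ μ : List ℕ) → hPart κ μ ≡ hPart μ κ
hPart-sym []      μ = sym (hPart-[] μ)
hPart-sym (a ∷ κ) μ = trans (⊛-congʳ (h a) (hPart-sym κ) μ) (sym (hPart-∷ a κ μ))

-- Power sums and Newton's identities

-- The power sum (junk value: p 0 = 0).
p : ℕ → Series
p k []          = 0ℚ
p k (zero  ∷ μ) = p k μ
p k (suc m ∷ μ) = δ (suc m) k * oneS μ

pPart : List ℕ → Series
pPart γ = prodS (map p γ)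

-- Subtraction in ℕ as a partial function: at most one value.
minus : ℕ → ℕ → List ℕ
minus zero    m       = m ∷ []
minus (suc k) zero    = []
minus (suc k) (suc m) = minus k m

-- The exponents of the monomials obtained from the one with exponent `μ` on division by the `k`-th
-- power of a single variable, one for each variable that allows it.
removals : ℕ → List ℕ → List (List ℕ)
removals k []      = []
removals k (m ∷ μ) = map (_∷ μ) (minus k m) ++ map (m ∷_) (removals k μ)

conv-minus : (k m : ℕ) (G : ℕ → ℚ) → conv (λ a b → δ a k * G b) m ≡ ∑ (minus k m) G
conv-minus zero    m       G = begin
  conv (λ a b → δ a 0 * G b) m  ≡⟨ conv-single (λ a b → δ a 0 * G b) m (λ i j → *-zeroˡ (G j)) ⟩
  1ℚ * G m                      ≡⟨ trans (*-identityˡ (G m)) (sym (+-identityʳ (G m))) ⟩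
  G m + 0ℚ                      ∎
conv-minus (suc k) zero    G = trans (+-identityʳ (0ℚ * G 0)) (*-zeroˡ (G 0))
conv-minus (suc k) (suc m) G = begin
  conv (λ a b → δ a (suc k) * G b) (suc m)                    ≡⟨ conv-suc (λ a b → δ a (suc k) * G b) m ⟩
  0ℚ * G (suc m) + conv (λ a b → δ a k * G b) m               ≡⟨ cong₂ _+_ (*-zeroˡ (G (suc m))) (conv-minus k m G) ⟩
  0ℚ + ∑ (minus k m) G                                        ≡⟨ +-identityˡ (∑ (minus k m) G) ⟩
  ∑ (minus k m) G                                             ∎

∑-removals-∷ : (k m : ℕ) (μ : List ℕ) (F : Series) →
  ∑ (removals k (m ∷ μ)) F ≡ ∑ (minus k m) (λ x → F (x ∷ μ)) + ∑ (removals k μ) (F at m)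
∑-removals-∷ k m μ F = trans (∑-++ (map (_∷ μ) (minus k m)) (map (m ∷_) (removals k μ)) F)
  (cong₂ _+_ (∑-map (_∷ μ) (minus k m) F) (∑-map (m ∷_) (removals k μ) F))

-- Multiplication by a power of one variable shifts the coefficients of `F`, and a power sum adds up
-- these shifts. All later use of power sums goes through this formula.
p-⊛ : (k : ℕ) (F : Series) → (p (suc k) ⊛ F) ≈ₛ (λ μ → ∑ (removals (suc k) μ) F)
p-⊛ k F []          = trans (⊛-[] (p (suc k)) F) (*-zeroˡ (F []))
p-⊛ k F (zero ∷ μ)  = begin
  (p (suc k) ⊛ F) (0 ∷ μ)                   ≡⟨ ⊛-∷ (p (suc k)) F 0 μ ⟩
  (p (suc k) ⊛ (F at 0)) μ + 0ℚ             ≡⟨ +-identityʳ ((p (suc k) ⊛ (F at 0)) μ) ⟩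
  (p (suc k) ⊛ (F at 0)) μ                  ≡⟨ p-⊛ k (F at 0) μ ⟩
  ∑ (removals (suc k) μ) (F at 0)           ≡⟨ ∑-map (0 ∷_) (removals (suc k) μ) F ⟨
  ∑ (removals (suc k) (0 ∷ μ)) F            ∎
p-⊛ k F (suc m ∷ μ) = begin
  (p (suc k) ⊛ F) (suc m ∷ μ)
    ≡⟨ ⊛-∷ (p (suc k)) F (suc m) μ ⟩
  conv (λ i j → ((p (suc k) at i) ⊛ (F at j)) μ) (suc m)
    ≡⟨ conv-suc (λ i j → ((p (suc k) at i) ⊛ (F at j)) μ) m ⟩
  (p (suc k) ⊛ (F at suc m)) μ + conv (λ i j → ((δ i k ⋆ oneS) ⊛ (F at j)) μ) m
    ≡⟨ cong₂ _+_ (p-⊛ k (F at suc m) μ) (conv-cong m (λ i j →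
         trans (⊛-⋆ˡ (δ i k) oneS (F at j) μ) (cong (δ i k *_) (⊛-identityˡ (F at j) μ)))) ⟩
  ∑ (removals (suc k) μ) (F at suc m) + conv (λ i j → δ i k * F (j ∷ μ)) m
    ≡⟨ cong (∑ (removals (suc k) μ) (F at suc m) +_) (conv-minus k m (λ j → F (j ∷ μ))) ⟩
  ∑ (removals (suc k) μ) (F at suc m) + ∑ (minus k m) (λ x → F (x ∷ μ))
    ≡⟨ +-comm (∑ (removals (suc k) μ) (F at suc m)) _ ⟩
  ∑ (minus k m) (λ x → F (x ∷ μ)) + ∑ (removals (suc k) μ) (F at suc m)
    ≡⟨ ∑-removals-∷ (suc k) (suc m) μ F ⟨
  ∑ (removals (suc k) (suc m ∷ μ)) F ∎

fromℕ : ℕ → ℚ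
fromℕ zero    = 0ℚ
fromℕ (suc n) = 1ℚ + fromℕ n

fromℕ-+ : (m n : ℕ) → fromℕ (m ℕ.+ n) ≡ fromℕ m + fromℕ n
fromℕ-+ zero    n = sym (+-identityˡ (fromℕ n))
fromℕ-+ (suc m) n = trans (cong (1ℚ +_) (fromℕ-+ m n)) (sym (+-assoc 1ℚ (fromℕ m) (fromℕ n)))

minus-total : (k m : ℕ) → m ≤ k → conv (λ i _ → ∑ (minus i m) (λ _ → 1ℚ)) k ≡ fromℕ (suc m)
minus-total k       zero    _         = conv-single (λ i _ → ∑ (minus i 0) (λ _ → 1ℚ)) k (λ _ _ → refl)
minus-total (suc k) (suc m) (s≤s m≤k) =
  trans (conv-suc (λ i _ → ∑ (minus i (suc m)) (λ _ → 1ℚ)) k) (cong (1ℚ +_) (minus-total k m m≤k))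

-- An entry `m` admits the subtraction of each of 1, ..., m, and the bound on the total puts all of
-- these among 1, ..., k + 1. The total number of subtractions is the factor in Newton's identity.
removals-total : (k : ℕ) (μ : List ℕ) → sumℕ μ ≤ suc k →
  conv (λ i _ → ∑ (removals (suc i) μ) (λ _ → 1ℚ)) k ≡ fromℕ (sumℕ μ)
removals-total k []      _ = ∑-zero (antidiagonal k)
removals-total k (m ∷ μ) l = begin
  conv (λ i _ → ∑ (removals (suc i) (m ∷ μ)) (λ _ → 1ℚ)) k
    ≡⟨ conv-cong k (λ i _ → ∑-removals-∷ (suc i) m μ (λ _ → 1ℚ)) ⟩
  conv (λ i _ → ∑ (minus (suc i) m) (λ _ → 1ℚ) + ∑ (removals (suc i) μ) (λ _ → 1ℚ)) k
    ≡⟨ conv-+ k (λ i _ → ∑ (minus (suc i) m) (λ _ → 1ℚ)) (λ i _ → ∑ (removals (suc i) μ) (λ _ → 1ℚ)) ⟩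
  conv (λ i _ → ∑ (minus (suc i) m) (λ _ → 1ℚ)) k + conv (λ i _ → ∑ (removals (suc i) μ) (λ _ → 1ℚ)) k
    ≡⟨ cong₂ _+_ (first m (ℕ.≤-trans (ℕ.m≤m+n m (sumℕ μ)) l)) (removals-total k μ (ℕ.≤-trans (ℕ.m≤n+m (sumℕ μ) m) l)) ⟩
  fromℕ m + fromℕ (sumℕ μ)
    ≡⟨ fromℕ-+ m (sumℕ μ) ⟨
  fromℕ (m ℕ.+ sumℕ μ) ∎
  where
  first : ∀ m → m ≤ suc k → conv (λ i _ → ∑ (minus (suc i) m) (λ _ → 1ℚ)) k ≡ fromℕ m
  first zero    _         = ∑-zero (antidiagonal k)
  first (suc m) (s≤s m≤k) = minus-total k m m≤k

antidiagonal-+ : (m : ℕ) → All (λ (i , j) → i ℕ.+ j ≡ m) (antidiagonal m)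
antidiagonal-+ zero    = refl ∷ []
antidiagonal-+ (suc m) = refl ∷ All.map⁺ (All.map (cong suc) (antidiagonal-+ m))

conv-congᴬ : {f g : ℕ → ℕ → ℚ} (m : ℕ) → (∀ i j → i ℕ.+ j ≡ m → f i j ≡ g i j) → conv f m ≡ conv g m
conv-congᴬ m e = ∑-congᴬ (All.map (λ {ij} → e (proj₁ ij) (proj₂ ij)) (antidiagonal-+ m))

minus-+ : (k m : ℕ) → All (λ x → k ℕ.+ x ≡ m) (minus k m)
minus-+ zero    m       = refl ∷ []
minus-+ (suc k) zero    = []
minus-+ (suc k) (suc m) = All.map (cong suc) (minus-+ k m)

removals-sum : (k : ℕ) (μ : List ℕ) → All (λ ν → k ℕ.+ sumℕ ν ≡ sumℕ μ) (removals k μ)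
removals-sum k []      = []
removals-sum k (m ∷ μ) = All.++⁺
  (All.map⁺ (All.map (λ {x} e → trans (sym (ℕ.+-assoc k x (sumℕ μ))) (cong (ℕ._+ sumℕ μ) e)) (minus-+ k m)))
  (All.map⁺ (All.map (λ {ν} e → trans (trans (sym (ℕ.+-assoc k m (sumℕ ν))) (cong (ℕ._+ sumℕ ν) (ℕ.+-comm k m)))
                                (trans (ℕ.+-assoc m k (sumℕ ν)) (cong (m ℕ.+_) e))) (removals-sum k μ)))

δ-shift : (k x j : ℕ) → δ x j ≡ δ (k ℕ.+ x) (k ℕ.+ j)
δ-shift zero    x j = refl
δ-shift (suc k) x j = δ-shift k x j

δ-≢ : {x k : ℕ} → x ≢ k → δ x k ≡ 0ℚ
δ-≢ {x} {k} x≢k with ℕ.<-cmp x k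
... | tri< x<k _ _ = cong (if_then 1ℚ else 0ℚ) (<⇒≢ᵇ x<k)
... | tri≈ _ x≡k _ = ⊥-elim (x≢k x≡k)
... | tri> _ _ k<x = cong (if_then 1ℚ else 0ℚ) (>⇒≢ᵇ k<x)

-- At an exponent of degree k + 1, every removal leaves an exponent of the degree that `h j` asks
-- for and so contributes 1; the number of removals is the degree. At all other exponents both sides
-- vanish.
newton : (k : ℕ) → (λ μ → conv (λ i j → (p (suc i) ⊛ h j) μ) k) ≈ₛ (fromℕ (suc k) ⋆ h (suc k))
newton k μ = begin
  conv (λ i j → (p (suc i) ⊛ h j) μ) k
    ≡⟨ conv-congᴬ k (λ i j e → trans (p-⊛ i (h j) μ) (∑-congᴬ (All.map (λ {ν} → term i j e ν) (removals-sum (suc i) μ)))) ⟩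
  conv (λ i j → ∑ (removals (suc i) μ) (λ _ → 1ℚ * h (suc k) μ)) k
    ≡⟨ conv-cong k (λ i j → ∑-*ʳ (removals (suc i) μ) (h (suc k) μ) (λ _ → 1ℚ)) ⟩
  conv (λ i j → ∑ (removals (suc i) μ) (λ _ → 1ℚ) * h (suc k) μ) k
    ≡⟨ ∑-*ʳ (antidiagonal k) (h (suc k) μ) _ ⟩
  conv (λ i j → ∑ (removals (suc i) μ) (λ _ → 1ℚ)) k * h (suc k) μ
    ≡⟨ total ⟩
  fromℕ (suc k) * h (suc k) μ ∎
  where
  term : ∀ i j → i ℕ.+ j ≡ k → ∀ ν → suc i ℕ.+ sumℕ ν ≡ sumℕ μ → h j ν ≡ 1ℚ * h (suc k) μ
  term i j e ν e′ = begin
    δ (sumℕ ν) j                           ≡⟨ δ-shift (suc i) (sumℕ ν) j ⟩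
    δ (suc i ℕ.+ sumℕ ν) (suc i ℕ.+ j)     ≡⟨ cong₂ δ e′ (cong suc e) ⟩
    δ (sumℕ μ) (suc k)                     ≡⟨ *-identityˡ (δ (sumℕ μ) (suc k)) ⟨
    1ℚ * h (suc k) μ                       ∎
  total : conv (λ i j → ∑ (removals (suc i) μ) (λ _ → 1ℚ)) k * h (suc k) μ ≡ fromℕ (suc k) * h (suc k) μ
  total with sumℕ μ ℕ.≟ suc k
  ... | yes e = cong (_* h (suc k) μ) (trans (removals-total k μ (ℕ.≤-reflexive e)) (cong fromℕ e))
  ... | no ne = trans (cong (conv (λ i j → ∑ (removals (suc i) μ) (λ _ → 1ℚ)) k *_) (δ-≢ ne))
                      (trans (*-zeroʳ (conv (λ i j → ∑ (removals (suc i) μ) (λ _ → 1ℚ)) k)) (sym (trans (cong (fromℕ (suc k) *_) (δ-≢ ne)) (*-zeroʳ (fromℕ (suc k))))))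

h-zero : h 0 ≈ₛ oneS
h-zero []          = refl
h-zero (zero  ∷ μ) = h-zero μ
h-zero (suc m ∷ μ) = refl

-- From complete homogeneous functions to power sums

module _ (C C′ : List (List ℕ)) where

  -- The point evaluations are coefficient extractions at the members of `C` and `C′`. Quantifying
  -- over `μ` makes the property stable under multiplication by any `h j`, which the mixed terms of
  -- Newton's identity require.
  Balanced : Series → Set
  Balanced F = ∀ μ → ∑ C (hPart μ ⊛ F) ≡ ∑ C′ (hPart μ ⊛ F)

  module _ {F : Series} (F-bal : Balanced F) where

    private
      term : (List (List ℕ)) → List ℕ → ℕ → ℕ → ℚ
      term D μ i j = ∑ D (hPart (j ∷ μ) ⊛ (p (suc i) ⊛ F))

      newton-term : (D : List (List ℕ)) (μ : List ℕ) (k : ℕ) →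
                    conv (term D μ) k ≡ fromℕ (suc k) * ∑ D (hPart (suc k ∷ μ) ⊛ F)
      newton-term D μ k = begin
        conv (λ i j → ∑ D ((h j ⊛ hPart μ) ⊛ (p (suc i) ⊛ F))) k
          ≡⟨ conv-cong k (λ i j → ∑-cong D (λ ν → rearrange i j ν)) ⟩
        conv (λ i j → ∑ D ((p (suc i) ⊛ h j) ⊛ (hPart μ ⊛ F))) k
          ≡⟨ ∑-swap (antidiagonal k) D (λ (i , j) → (p (suc i) ⊛ h j) ⊛ (hPart μ ⊛ F)) ⟩
        ∑ D (λ ν → conv (λ i j → ((p (suc i) ⊛ h j) ⊛ (hPart μ ⊛ F)) ν) k)
          ≡⟨ ∑-cong D (λ ν → begin
               conv (λ i j → ((p (suc i) ⊛ h j) ⊛ (hPart μ ⊛ F)) ν) k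
                 ≡⟨ ⊛-∑ˡ (antidiagonal k) (λ (i , j) → p (suc i) ⊛ h j) (hPart μ ⊛ F) ν ⟨
               ((λ κ → conv (λ i j → (p (suc i) ⊛ h j) κ) k) ⊛ (hPart μ ⊛ F)) ν
                 ≡⟨ ⊛-congˡ (hPart μ ⊛ F) (newton k) ν ⟩
               ((fromℕ (suc k) ⋆ h (suc k)) ⊛ (hPart μ ⊛ F)) ν
                 ≡⟨ ⊛-⋆ˡ (fromℕ (suc k)) (h (suc k)) (hPart μ ⊛ F) ν ⟩
               fromℕ (suc k) * (h (suc k) ⊛ (hPart μ ⊛ F)) ν
                 ≡⟨ cong (fromℕ (suc k) *_) (⊛-assoc (h (suc k)) (hPart μ) F ν) ⟨
               fromℕ (suc k) * (hPart (suc k ∷ μ) ⊛ F) ν ∎) ⟩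
        ∑ D (λ ν → fromℕ (suc k) * (hPart (suc k ∷ μ) ⊛ F) ν)
          ≡⟨ ∑-*ˡ D (fromℕ (suc k)) (hPart (suc k ∷ μ) ⊛ F) ⟩
        fromℕ (suc k) * ∑ D (hPart (suc k ∷ μ) ⊛ F) ∎
        where
        rearrange : ∀ i j → ((h j ⊛ hPart μ) ⊛ (p (suc i) ⊛ F)) ≈ₛ ((p (suc i) ⊛ h j) ⊛ (hPart μ ⊛ F))
        rearrange i j ν = begin
          ((h j ⊛ hPart μ) ⊛ (p (suc i) ⊛ F)) ν   ≡⟨ ⊛-leftComm (h j ⊛ hPart μ) (p (suc i)) F ν ⟩
          (p (suc i) ⊛ ((h j ⊛ hPart μ) ⊛ F)) ν   ≡⟨ ⊛-congʳ (p (suc i)) (⊛-assoc (h j) (hPart μ) F) ν ⟩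
          (p (suc i) ⊛ (h j ⊛ (hPart μ ⊛ F))) ν   ≡⟨ ⊛-assoc (p (suc i)) (h j) (hPart μ ⊛ F) ν ⟨
          ((p (suc i) ⊛ h j) ⊛ (hPart μ ⊛ F)) ν   ∎

      newton-balanced : (μ : List ℕ) (k : ℕ) → conv (term C μ) k ≡ conv (term C′ μ) k
      newton-balanced μ k = trans (newton-term C μ k)
        (trans (cong (fromℕ (suc k) *_) (F-bal (suc k ∷ μ))) (sym (newton-term C′ μ k)))

      drop-zero : (D : List (List ℕ)) (μ : List ℕ) (k : ℕ) → term D μ k 0 ≡ ∑ D (hPart μ ⊛ (p (suc k) ⊛ F))
      drop-zero D μ k = ∑-cong D (⊛-congˡ (p (suc k) ⊛ F) (λ ν →
        trans (⊛-congˡ (hPart μ) h-zero ν) (⊛-identityˡ (hPart μ) ν)))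

    -- Strong induction on `k`, with `n` as bound. In Newton's identity times `hPart μ ⊛ F`, the
    -- right side is balanced by assumption and the terms with a lower power sum by induction, their
    -- factor `h` being absorbed into `μ`. Cancelling them leaves the last term, where `h 0` is the
    -- unit.
    p-balanced-below : (n k : ℕ) → k < n → Balanced (p (suc k) ⊛ F)
    p-balanced-below (suc n) zero    _           μ = begin
      ∑ C (hPart μ ⊛ (p 1 ⊛ F))   ≡⟨ trans (+-identityʳ (term C μ 0 0)) (drop-zero C μ 0) ⟨
      conv (term C μ) 0           ≡⟨ newton-balanced μ 0 ⟩
      conv (term C′ μ) 0          ≡⟨ trans (+-identityʳ (term C′ μ 0 0)) (drop-zero C′ μ 0) ⟩
      ∑ C′ (hPart μ ⊛ (p 1 ⊛ F))  ∎
    p-balanced-below (suc n) (suc k) (s≤s k<n) μ = begin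
      ∑ C (hPart μ ⊛ (p (suc (suc k)) ⊛ F))   ≡⟨ drop-zero C μ (suc k) ⟨
      term C μ (suc k) 0                      ≡⟨ cancel _ _ (begin
        rest C + term C μ (suc k) 0     ≡⟨ conv-snoc (term C μ) k ⟨
        conv (term C μ) (suc k)         ≡⟨ newton-balanced μ (suc k) ⟩
        conv (term C′ μ) (suc k)        ≡⟨ conv-snoc (term C′ μ) k ⟩
        rest C′ + term C′ μ (suc k) 0   ≡⟨ cong (_+ term C′ μ (suc k) 0) rest-balanced ⟨
        rest C + term C′ μ (suc k) 0    ∎) ⟩
      term C′ μ (suc k) 0                     ≡⟨ drop-zero C′ μ (suc k) ⟩
      ∑ C′ (hPart μ ⊛ (p (suc (suc k)) ⊛ F))  ∎
      where
      rest : List (List ℕ) → ℚ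
      rest D = conv (λ i j → term D μ i (suc j)) k
      rest-balanced : rest C ≡ rest C′
      rest-balanced = conv-congᴬ k λ i j e →
        p-balanced-below n i (ℕ.≤-<-trans (ℕ.≤-trans (ℕ.m≤m+n i j) (ℕ.≤-reflexive e)) k<n) (suc j ∷ μ)
      cancel : ∀ x y → rest C + x ≡ rest C + y → x ≡ y
      cancel x y = ∙-cancelˡ (rest C) x y

  pPart-balanced : (∀ μ → ∑ C (λ γ → hPart γ μ) ≡ ∑ C′ (λ γ → hPart γ μ)) →
                   ∀ {γ} → All (0 <_) γ → Balanced (pPart γ)
  pPart-balanced e []                 μ = begin
    ∑ C (hPart μ ⊛ oneS)     ≡⟨ ∑-cong C (unfold μ) ⟩
    ∑ C (λ γ → hPart γ μ)    ≡⟨ e μ ⟩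
    ∑ C′ (λ γ → hPart γ μ)   ≡⟨ ∑-cong C′ (unfold μ) ⟨
    ∑ C′ (hPart μ ⊛ oneS)    ∎
    where
    unfold : ∀ μ γ → (hPart μ ⊛ oneS) γ ≡ hPart γ μ
    unfold μ γ = trans (⊛-comm (hPart μ) oneS γ) (trans (⊛-identityˡ (hPart μ) γ) (hPart-sym μ γ))
  pPart-balanced e {suc k ∷ γ} (_ ∷ ps) = p-balanced-below {F = pPart γ} (pPart-balanced e ps) (suc k) k (ℕ.n<1+n k)

  ∑-pPart : (∀ μ → ∑ C (λ γ → hPart γ μ) ≡ ∑ C′ (λ γ → hPart γ μ)) →
            ∀ {γ} → All (0 <_) γ → ∑ C (pPart γ) ≡ ∑ C′ (pPart γ)
  ∑-pPart e {γ} ps = begin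
    ∑ C (pPart γ)            ≡⟨ ∑-cong C (⊛-identityˡ (pPart γ)) ⟨
    ∑ C (oneS ⊛ pPart γ)     ≡⟨ pPart-balanced e ps [] ⟩
    ∑ C′ (oneS ⊛ pPart γ)    ≡⟨ ∑-cong C′ (⊛-identityˡ (pPart γ)) ⟩
    ∑ C′ (pPart γ)           ∎

-- Sign and support of power sum products

∑-nonNeg : {A : Set} (xs : List A) {f : A → ℚ} → (∀ x → 0ℚ ℚ.≤ f x) → 0ℚ ℚ.≤ ∑ xs f
∑-nonNeg []       _ = ≤-refl
∑-nonNeg (x ∷ xs) p = +-mono-≤ (p x) (∑-nonNeg xs p)

∑-pos : {A : Set} {xs : List A} {f : A → ℚ} → (∀ x → 0ℚ ℚ.≤ f x) → Any (λ x → 0ℚ ℚ.< f x) xs → 0ℚ ℚ.< ∑ xs f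
∑-pos {xs = _ ∷ xs} p (here 0<fx) = +-mono-<-≤ 0<fx (∑-nonNeg xs p)
∑-pos {xs = x ∷ _}  p (there i)   = +-mono-≤-< (p x) (∑-pos p i)

∑-≢0 : {A : Set} (xs : List A) (f : A → ℚ) → ∑ xs f ≢ 0ℚ → Any (λ x → f x ≢ 0ℚ) xs
∑-≢0 []       f s≢0 = ⊥-elim (s≢0 refl)
∑-≢0 (x ∷ xs) f s≢0 with f x ≟ 0ℚ
... | no fx≢0  = here fx≢0
... | yes fx≡0 = there (∑-≢0 xs f (λ e → s≢0 (cong₂ _+_ fx≡0 e)))

oneS-nonNeg : (μ : List ℕ) → 0ℚ ℚ.≤ oneS μ
oneS-nonNeg μ with allZero μ
... | true  = nonNegative⁻¹ 1ℚ
... | false = ≤-refl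

pPart-∷ : (k : ℕ) (γ μ : List ℕ) → pPart (suc k ∷ γ) μ ≡ ∑ (removals (suc k) μ) (pPart γ)
pPart-∷ k γ = p-⊛ k (pPart γ)

pPart-nonNeg : {γ : List ℕ} → All (0 <_) γ → (μ : List ℕ) → 0ℚ ℚ.≤ pPart γ μ
pPart-nonNeg []                     μ = oneS-nonNeg μ
pPart-nonNeg {suc k ∷ γ} (_ ∷ ps) μ =
  subst (0ℚ ℚ.≤_) (sym (pPart-∷ k γ μ)) (∑-nonNeg (removals (suc k) μ) (pPart-nonNeg ps))

pPart-0∷ : {γ : List ℕ} → All (0 <_) γ → (μ : List ℕ) → pPart γ (0 ∷ μ) ≡ pPart γ μ
pPart-0∷ []                   μ = refl
pPart-0∷ {suc k ∷ γ} (_ ∷ ps) μ = begin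
  pPart (suc k ∷ γ) (0 ∷ μ)                         ≡⟨ pPart-∷ k γ (0 ∷ μ) ⟩
  ∑ (map (0 ∷_) (removals (suc k) μ)) (pPart γ)     ≡⟨ ∑-map (0 ∷_) (removals (suc k) μ) (pPart γ) ⟩
  ∑ (removals (suc k) μ) (λ ν → pPart γ (0 ∷ ν))    ≡⟨ ∑-cong (removals (suc k) μ) (pPart-0∷ ps) ⟩
  ∑ (removals (suc k) μ) (pPart γ)                  ≡⟨ pPart-∷ k γ μ ⟨
  pPart (suc k ∷ γ) μ                               ∎

minus-self : (k : ℕ) → minus k k ≡ 0 ∷ []
minus-self zero    = refl
minus-self (suc k) = minus-self k

-- Subtracting every part of `γ` from its own entry gives one positive contribution, and no
-- contribution is negative. The zero left behind by each subtraction is discarded by `pPart-0∷`.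
pPart-diagonal : {γ : List ℕ} → All (0 <_) γ → 0ℚ ℚ.< pPart γ γ
pPart-diagonal []                   = positive⁻¹ 1ℚ
pPart-diagonal {suc k ∷ γ} (_ ∷ ps) = subst (0ℚ ℚ.<_) (sym (pPart-∷ k γ (suc k ∷ γ)))
  (∑-pos (pPart-nonNeg ps) (subst (λ l → Any (λ ν → 0ℚ ℚ.< pPart γ ν) (map (_∷ γ) l ++ map (suc k ∷_) (removals (suc k) γ)))
    (sym (minus-self k)) (here (subst (0ℚ ℚ.<_) (sym (pPart-0∷ ps γ)) (pPart-diagonal ps)))))

nonzeros : List ℕ → List ℕ
nonzeros []          = []
nonzeros (zero  ∷ μ) = nonzeros μ
nonzeros (suc m ∷ μ) = suc m ∷ nonzeros μ

nonzeros-positive : {μ : List ℕ} → All (0 <_) μ → nonzeros μ ≡ μ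
nonzeros-positive []                   = refl
nonzeros-positive {suc m ∷ μ} (_ ∷ ps) = cong (suc m ∷_) (nonzeros-positive ps)

oneS-support : (μ : List ℕ) → oneS μ ≢ 0ℚ → nonzeros μ ≡ []
oneS-support []          _ = refl
oneS-support (zero  ∷ μ) n = oneS-support μ n
oneS-support (suc m ∷ μ) n = ⊥-elim (n refl)

-- A subtraction either uses up its entry, which then equals the number subtracted, or leaves it
-- positive and the number of nonzero entries unchanged.
removals-nonzeros : (k : ℕ) (μ : List ℕ) →
  All (λ ν → (nonzeros μ ↭ suc k ∷ nonzeros ν) ⊎ (length (nonzeros μ) ≡ length (nonzeros ν))) (removals (suc k) μ)
removals-nonzeros k []      = []
removals-nonzeros k (m ∷ μ) = All.++⁺
  (All.map⁺ (All.map (λ {x} → subtracted x) (minus-+ (suc k) m)))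
  (All.map⁺ (All.map (λ {ν} → kept m {ν}) (removals-nonzeros k μ)))
  where
  subtracted : ∀ x {m} → suc k ℕ.+ x ≡ m →
    (nonzeros (m ∷ μ) ↭ suc k ∷ nonzeros (x ∷ μ)) ⊎ (length (nonzeros (m ∷ μ)) ≡ length (nonzeros (x ∷ μ)))
  subtracted zero    refl = inj₁ (↭.↭-reflexive (cong (λ m → suc m ∷ nonzeros μ) (ℕ.+-identityʳ k)))
  subtracted (suc x) refl = inj₂ refl
  kept : ∀ m {ν} → (nonzeros μ ↭ suc k ∷ nonzeros ν) ⊎ (length (nonzeros μ) ≡ length (nonzeros ν)) →
    (nonzeros (m ∷ μ) ↭ suc k ∷ nonzeros (m ∷ ν)) ⊎ (length (nonzeros (m ∷ μ)) ≡ length (nonzeros (m ∷ ν)))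
  kept zero    r        = r
  kept (suc m) (inj₁ r) = inj₁ (↭.trans (prep (suc m) r) (swap (suc m) (suc k) ↭.refl))
  kept (suc m) (inj₂ e) = inj₂ (cong suc e)

-- A nonzero value requires all entries to be used up in as many subtractions as `γ` has parts, and
-- each subtraction uses up at most one entry. If there are as many nonzero entries as parts, each
-- part must use up an entry equal to it.
pPart-nonzeros : {γ : List ℕ} → All (0 <_) γ → (μ : List ℕ) → pPart γ μ ≢ 0ℚ →
  length (nonzeros μ) < length γ ⊎ nonzeros μ ↭ γ
pPart-nonzeros []                   μ n = inj₂ (↭.↭-reflexive (oneS-support μ n))
pPart-nonzeros {suc k ∷ γ} (_ ∷ ps) μ n =
  combine (find (∑-≢0 (removals (suc k) μ) (pPart γ) (λ e → n (trans (pPart-∷ k γ μ) e))))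
  where
  combine : (∃ λ ν → ν ∈ removals (suc k) μ × pPart γ ν ≢ 0ℚ) → length (nonzeros μ) < suc (length γ) ⊎ nonzeros μ ↭ suc k ∷ γ
  combine (ν , ν∈ , n′) with All.lookup (removals-nonzeros k μ) ν∈ | pPart-nonzeros ps ν n′
  ... | inj₁ r | inj₁ l  = inj₁ (s≤s (subst (_≤ length γ) (sym (↭-length r)) l))
  ... | inj₁ r | inj₂ r′ = inj₂ (↭.trans r (prep (suc k) r′))
  ... | inj₂ e | inj₁ l  = inj₁ (subst (_< suc (length γ)) (sym e) (ℕ.m<n⇒m<1+n l))
  ... | inj₂ e | inj₂ r′ = inj₁ (s≤s (ℕ.≤-reflexive (trans e (↭-length r′))))

pPart-support : {γ μ : List ℕ} → All (0 <_) γ → All (0 <_) μ → pPart γ μ ≢ 0ℚ → length μ < length γ ⊎ μ ↭ γ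
pPart-support {γ} {μ} ps qs n =
  subst (λ ν → length ν < length γ ⊎ ν ↭ γ) (nonzeros-positive qs) (pPart-nonzeros ps μ n)

-- Recovering a multiset of partitions from its sum of products

Positive : List (List ℕ) → Set
Positive = All (All (0 <_))

SameHSum : List (List ℕ) → List (List ℕ) → Set
SameHSum C C′ = ∀ μ → ∑ C (λ γ → hPart γ μ) ≡ ∑ C′ (λ γ → hPart γ μ)

-- By pPart-support, a member γ of C is matched in C′ or C′ has a shorter member; the roles of C and C′ then alternate.
common-member : (n : ℕ) {C C′ : List (List ℕ)} → Positive C → Positive C′ → SameHSum C C′ →
  {γ : List ℕ} → γ ∈ C → length γ < n → ∃₂ λ γ₁ γ₂ → γ₁ ∈ C × γ₂ ∈ C′ × γ₁ ↭ γ₂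
common-member (suc n) {C} {C′} pos pos′ e {γ} γ∈ (s≤s l) = select (find (∑-≢0 C′ (pPart γ) ≢0))
  where
  ps : All (0 <_) γ
  ps = All.lookup pos γ∈
  ≢0 : ∑ C′ (pPart γ) ≢ 0ℚ
  ≢0 s≡0 = <-irrefl (sym (trans (∑-pPart C C′ e ps) s≡0)) (∑-pos (pPart-nonNeg ps) (lose γ∈ (pPart-diagonal ps)))
  select : (∃ λ κ → κ ∈ C′ × pPart γ κ ≢ 0ℚ) → ∃₂ λ γ₁ γ₂ → γ₁ ∈ C × γ₂ ∈ C′ × γ₁ ↭ γ₂
  select (κ , κ∈ , n≢) with pPart-support ps (All.lookup pos′ κ∈) n≢
  ... | inj₂ r  = γ , κ , γ∈ , κ∈ , ↭-sym r
  ... | inj₁ l′ with common-member n pos′ pos (λ μ → sym (e μ)) κ∈ (ℕ.<-≤-trans l′ l)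
  ...   | γ₁ , γ₂ , i , j , r = γ₂ , γ₁ , j , i , ↭-sym r

hPart-↭ : {γ κ : List ℕ} → γ ↭ κ → hPart γ ≈ₛ hPart κ
hPart-↭ {γ} {κ} r μ = begin
  hPart γ μ                 ≡⟨ hPart-partitionOf γ μ ⟨
  hPart (partitionOf γ) μ   ≡⟨ cong (λ x → hPart x μ) (partitionOf-↭ r) ⟩
  hPart (partitionOf κ) μ   ≡⟨ hPart-partitionOf κ μ ⟩
  hPart κ μ                 ∎

-- Members that are rearrangements of each other have the same `hPart`, so a pair found by
-- `common-member` can be removed from both lists without disturbing the equality of the sums. If
-- one list is empty, `common-member` forces the other to be empty too.
hPart-independent : (n : ℕ) {C C′ : List (List ℕ)} → length C ≤ n → Positive C → Positive C′ → SameHSum C C′ →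
  map partitionOf C ↭ map partitionOf C′
hPart-independent n {[]} {[]}     _ _ _ _ = ↭.refl
hPart-independent n {[]} {γ ∷ C′} _ pos pos′ e
  with common-member (suc (length γ)) pos′ pos (λ μ → sym (e μ)) (here refl) (ℕ.n<1+n (length γ))
... | _ , _ , _ , () , _
hPart-independent (suc n) {γ ∷ C} {C′} (s≤s l) pos pos′ e
  with common-member (suc (length γ)) pos pos′ e (here refl) (ℕ.n<1+n (length γ))
... | γ₁ , γ₂ , i , j , r with ∈-∃++ i | ∈-∃++ j
... | xs , ys , eq | xs′ , ys′ , refl = ↭.trans (map⁺ partitionOf s)
    (↭.trans (↭.trans (↭.↭-reflexive (cong (_∷ map partitionOf (xs ++ ys)) (partitionOf-↭ r)))
                      (prep (partitionOf γ₂) (hPart-independent n l′ (All.tail (All-resp-↭ s pos)) (All.tail (All-resp-↭ s′ pos′)) rest)))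
             (↭-sym (map⁺ partitionOf s′)))
  where
  s : γ ∷ C ↭ γ₁ ∷ xs ++ ys
  s = ↭.trans (↭.↭-reflexive eq) (shift γ₁ xs ys)
  s′ : xs′ ++ γ₂ ∷ ys′ ↭ γ₂ ∷ xs′ ++ ys′
  s′ = shift γ₂ xs′ ys′
  l′ : length (xs ++ ys) ≤ n
  l′ = subst (_≤ n) (ℕ.suc-injective (↭-length s)) l
  rest : SameHSum (xs ++ ys) (xs′ ++ ys′)
  rest μ = ∙-cancelˡ (hPart γ₁ μ) _ _ (begin
    ∑ (γ₁ ∷ xs ++ ys) H                   ≡⟨ ∑-↭ H s ⟨
    ∑ (γ ∷ C) H                           ≡⟨ e μ ⟩
    ∑ (xs′ ++ γ₂ ∷ ys′) H                 ≡⟨ ∑-↭ H s′ ⟩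
    hPart γ₂ μ + ∑ (xs′ ++ ys′) H         ≡⟨ cong (_+ ∑ (xs′ ++ ys′) H) (hPart-↭ r μ) ⟨
    hPart γ₁ μ + ∑ (xs′ ++ ys′) H         ∎)
    where
    H : List ℕ → ℚ
    H x = hPart x μ

-- Specialisation of q and equality of path polynomials

GP-at-1 : (a : ℕ) (r : List ℕ) → All (0 <_) (a ∷ r) → GP 1ℚ (a ∷ r) ≈ₛ hPart (a ∷ r)
GP-at-1 a []      _          μ = trans (GP-single 1ℚ a μ) (sym (trans (⊛-comm (h a) oneS μ) (⊛-identityˡ (h a) μ)))
GP-at-1 a (b ∷ r) (0<a ∷ ps) μ = begin
  -- At q = 1 the factor q - 1 of the near-concatenation is 0, so splitting off a part is plain
  -- multiplication.
  GP 1ℚ (a ∷ b ∷ r) μ                                   ≡⟨ solve 2 (λ x y → x := x :+ con 0ℚ :* y) refl (GP 1ℚ (a ∷ b ∷ r) μ) (GP 1ℚ (a ℕ.+ b ∷ r) μ) ⟩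
  GP 1ℚ (a ∷ b ∷ r) μ + 0ℚ * GP 1ℚ (a ℕ.+ b ∷ r) μ      ≡⟨ h⊛GP 1ℚ a (b ∷ r) 0<a (s≤s z≤n , ps) μ ⟨
  1ℚ * (h a ⊛ GP 1ℚ (b ∷ r)) μ                          ≡⟨ *-identityˡ ((h a ⊛ GP 1ℚ (b ∷ r)) μ) ⟩
  (h a ⊛ GP 1ℚ (b ∷ r)) μ                               ≡⟨ ⊛-congʳ (h a) (GP-at-1 b r ps) μ ⟩
  (h a ⊛ hPart (b ∷ r)) μ                               ∎

^ℚ-+ : (x : ℚ) (m n : ℕ) → (x ^ℚ m) * (x ^ℚ n) ≡ x ^ℚ (m ℕ.+ n)
^ℚ-+ x zero    n = *-identityˡ (x ^ℚ n)
^ℚ-+ x (suc m) n = trans (*-assoc x (x ^ℚ m) (x ^ℚ n)) (cong (x *_) (^ℚ-+ x m n))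

^ℚ-inverse : {x y : ℚ} → x * y ≡ 1ℚ → (n : ℕ) → (x ^ℚ n) * (y ^ℚ n) ≡ 1ℚ
^ℚ-inverse         e zero    = refl
^ℚ-inverse {x} {y} e (suc n) = begin
  (x * x ^ℚ n) * (y * y ^ℚ n)     ≡⟨ solve 4 (λ x a y b → (x :* a) :* (y :* b) := (x :* y) :* (a :* b)) refl x (x ^ℚ n) y (y ^ℚ n) ⟩
  (x * y) * (x ^ℚ n * y ^ℚ n)     ≡⟨ cong₂ _*_ e (^ℚ-inverse e n) ⟩
  1ℚ                              ∎

-- At q = ½ the coefficient of every coarsening is the same.
GP-at-½ : (a : ℕ) (r : List ℕ) → All (0 <_) (a ∷ r) →
  GP ℚ.½ (a ∷ r) ≈ₛ (λ μ → (ℚ.½ ^ℚ length r) * ∑ (coarsenings (a ∷ r)) (λ γ → hPart γ μ))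
GP-at-½ a r ps μ = begin
  GP ℚ.½ (a ∷ r) μ
    ≡⟨ GP-expansion ℚ.½ a r ps μ ⟩
  ∑ C (λ γ → ((ℚ.½ ^ℚ (length γ ∸ 1)) * (ℚ.½ ^ℚ (length (a ∷ r) ∸ length γ))) * hPart γ μ)
    ≡⟨ ∑-congᴬ (All.map (λ {γ} c → cong (_* hPart γ μ) (coeff γ c)) (coarsenings-bounded a r ps)) ⟩
  ∑ C (λ γ → (ℚ.½ ^ℚ length r) * hPart γ μ)
    ≡⟨ ∑-*ˡ C (ℚ.½ ^ℚ length r) (λ γ → hPart γ μ) ⟩
  (ℚ.½ ^ℚ length r) * ∑ C (λ γ → hPart γ μ) ∎
  where
  C = coarsenings (a ∷ r)
  coeff : ∀ γ → CoarseningOf (a ∷ r) γ → (ℚ.½ ^ℚ (length γ ∸ 1)) * (ℚ.½ ^ℚ (length (a ∷ r) ∸ length γ)) ≡ ℚ.½ ^ℚ length r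
  coeff (c ∷ γ) (_ , s≤s l) = trans (^ℚ-+ ℚ.½ (length γ) (length r ∸ length γ)) (cong (ℚ.½ ^ℚ_) (ℕ.m+[n∸m]≡n l))

coarsenings-positive : (a : ℕ) (r : List ℕ) → All (0 <_) (a ∷ r) → Positive (coarsenings (a ∷ r))
coarsenings-positive a r ps = All.map (λ c → proj₂ (proj₁ c)) (coarsenings-bounded a r ps)

GP-≈⇒𝓜-↭ : (α β : List ℕ) → IsComposition α → IsComposition β → (∀ q → GP q α ≈ₛ GP q β) → 𝓜 α ↭ 𝓜 β
GP-≈⇒𝓜-↭ (a ∷ r) (b ∷ s) (_ , ps) (_ , qs) e =
  hPart-independent (length C) ℕ.≤-refl (coarsenings-positive a r ps) (coarsenings-positive b s qs) sameSum
  where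
  C = coarsenings (a ∷ r)
  D = coarsenings (b ∷ s)
  sameParts : map partitionOf ((a ∷ r) ∷ []) ↭ map partitionOf ((b ∷ s) ∷ [])
  sameParts = hPart-independent 1 ℕ.≤-refl (ps ∷ []) (qs ∷ [])
    (λ μ → cong (_+ 0ℚ) (trans (sym (GP-at-1 a r ps μ)) (trans (e 1ℚ μ) (GP-at-1 b s qs μ))))
  -- Equal lengths are all that is needed from q = 1: they make the powers of ½ on both sides agree,
  -- so that multiplying by the same power of 2 removes them.
  sameLength : length r ≡ length s
  sameLength = ℕ.suc-injective (trans (sym (length-partitionOf (a ∷ r)))
    (trans (cong length (∷-injectiveˡ (↭-singleton-inv sameParts))) (length-partitionOf (b ∷ s))))
  2ℚ = 1ℚ + 1ℚ
  rescale : ∀ n x → x ≡ (2ℚ ^ℚ n) * ((ℚ.½ ^ℚ n) * x)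
  rescale n x = sym (trans (sym (*-assoc (2ℚ ^ℚ n) (ℚ.½ ^ℚ n) x))
    (trans (cong (_* x) (^ℚ-inverse {2ℚ} {ℚ.½} refl n)) (*-identityˡ x)))
  sameSum : SameHSum C D
  sameSum μ = begin
    ∑ C H                                                 ≡⟨ rescale (length r) (∑ C H) ⟩
    (2ℚ ^ℚ length r) * ((ℚ.½ ^ℚ length r) * ∑ C H)        ≡⟨ cong ((2ℚ ^ℚ length r) *_) (GP-at-½ a r ps μ) ⟨
    (2ℚ ^ℚ length r) * GP ℚ.½ (a ∷ r) μ                   ≡⟨ cong₂ (λ n x → (2ℚ ^ℚ n) * x) sameLength (e ℚ.½ μ) ⟩
    (2ℚ ^ℚ length s) * GP ℚ.½ (b ∷ s) μ                   ≡⟨ cong ((2ℚ ^ℚ length s) *_) (GP-at-½ b s qs μ) ⟩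
    (2ℚ ^ℚ length s) * ((ℚ.½ ^ℚ length s) * ∑ D H)        ≡⟨ rescale (length s) (∑ D H) ⟨
    ∑ D H                                                 ∎
    where
    H : List ℕ → ℚ
    H γ = hPart γ μ

GP-partitions : (q : ℚ) (α : List ℕ) → IsComposition α → GP q α ≈ₛ
  (λ μ → ∑ (𝓜 α) (λ lam → ((q ^ℚ (length lam ∸ 1)) * ((1ℚ - q) ^ℚ (length α ∸ length lam))) * hPart lam μ))
GP-partitions q α@(a ∷ r) (_ , ps) μ = trans (GP-expansion q a r ps μ) (sym (trans
  (∑-map partitionOf (coarsenings α) (λ lam → ((q ^ℚ (length lam ∸ 1)) * ((1ℚ - q) ^ℚ (length α ∸ length lam))) * hPart lam μ))
  (∑-cong (coarsenings α) (λ γ → cong₂ (λ n x → ((q ^ℚ (n ∸ 1)) * ((1ℚ - q) ^ℚ (length α ∸ n))) * x)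
    (length-partitionOf γ) (hPart-partitionOf γ μ)))))

-- The length of `α` is the greatest length in `𝓜 α`, attained by `α` itself. Used in both
-- directions, this shows that `𝓜` determines the length on which the coefficients of the expansion
-- depend.
𝓜-length : (α β : List ℕ) → IsComposition α → IsComposition β → 𝓜 α ↭ 𝓜 β → length α ≤ length β
𝓜-length α@(a ∷ r) β@(b ∷ s) _ (_ , qs) m = subst (_≤ length β) (length-partitionOf α)
  (All.lookup bounded (∈-resp-↭ m (∈-map⁺ partitionOf (∈-coarsenings a r))))
  where
  bounded : All (λ lam → length lam ≤ length β) (𝓜 β)
  bounded = All.map⁺ (All.map (λ {γ} c → ℕ.≤-trans (ℕ.≤-reflexive (length-partitionOf γ)) (proj₂ c)) (coarsenings-bounded b s qs))

𝓜-↭⇒GP-≈ : (α β : List ℕ) → IsComposition α → IsComposition β → 𝓜 α ↭ 𝓜 β → (q : ℚ) → GP q α ≈ₛ GP q β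
𝓜-↭⇒GP-≈ α β cα cβ m q μ = begin
  GP q α μ                      ≡⟨ GP-partitions q α cα μ ⟩
  ∑ (𝓜 α) (term (length α))     ≡⟨ ∑-↭ (term (length α)) m ⟩
  ∑ (𝓜 β) (term (length α))     ≡⟨ cong (λ n → ∑ (𝓜 β) (term n)) (ℕ.≤-antisym (𝓜-length α β cα cβ m) (𝓜-length β α cβ cα (↭-sym m))) ⟩
  ∑ (𝓜 β) (term (length β))     ≡⟨ GP-partitions q β cβ μ ⟨
  GP q β μ                      ∎
  where
  term : ℕ → List ℕ → ℚ
  term n lam = ((q ^ℚ (length lam ∸ 1)) * ((1ℚ - q) ^ℚ (n ∸ length lam))) * hPart lam μ

prodS-GP : (q : ℚ) (α : List ℕ) → prodS (map (λ a → GP q (a ∷ [])) α) ≈ₛ hPart α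
prodS-GP q = prodS-cong (GP-single q)

theorem4p12 : ((α β : List ℕ) → IsComposition α → IsComposition β →
    (q : ℚ) (q≢0 : q ≢ 0ℚ) →
    (GP q α ⊛ GP q β) ≈ₛ
    ((invℚ q q≢0 ⋆ GP q (α · β)) ⊕ (((q - 1ℚ) * invℚ q q≢0) ⋆ GP q (α ⊙ β))))
    × ((α : List ℕ) → IsComposition α →
    ((q : ℚ) → hPart (partitionOf α) ≈ₛ prodS (map (λ a → GP q (a ∷ [])) α))
    × ((q : ℚ) (q≢0 : q ≢ 0ℚ) →
    prodS (map (λ a → GP q (a ∷ [])) α) ≈ₛ
    sumS (map (λ β → (((q - 1ℚ) ^ℚ (length α ∸ length β)) * (invℚ q q≢0 ^ℚ (length α ∸ 1))) ⋆ GP q β)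
    (coarsenings α)))
    × ((q : ℚ) →
    GP q α ≈ₛ
    sumS (map (λ β → ((q ^ℚ (length β ∸ 1)) * ((1ℚ - q) ^ℚ (length α ∸ length β))) ⋆ hPart (partitionOf β))
    (coarsenings α)))
    × ((q : ℚ) →
    GP q α ≈ₛ
    sumS (map (λ lam → ((q ^ℚ (length lam ∸ 1)) * ((1ℚ - q) ^ℚ (length α ∸ length lam))) ⋆ hPart lam)
    (𝓜 α))))
    × ((α β : List ℕ) → IsComposition α → IsComposition β →
    (((q : ℚ) → GP q α ≈ₛ GP q β) ⇔ (𝓜 α ↭ 𝓜 β)))
theorem4p12 = product , expansions , λ α β cα cβ → mk⇔ (GP-≈⇒𝓜-↭ α β cα cβ) (𝓜-↭⇒GP-≈ α β cα cβ)
  where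
  product = λ α β cα cβ q q≢0 μ →
    divide q q≢0 ((GP q α ⊛ GP q β) μ) (GP q (α · β) μ) (GP q (α ⊙ β) μ) (GP-product q α β cα cβ μ)
  expansions = λ where
    α@(a ∷ r) cα@(_ , ps) →
        (λ q μ → trans (hPart-partitionOf α μ) (sym (prodS-GP q α μ)))
      , (λ q q≢0 μ → trans (trans (prodS-GP q α μ) (prodS-expansion q q≢0 a r ps μ))
          (sym (sumS-map (λ β → (((q - 1ℚ) ^ℚ (length α ∸ length β)) * (invℚ q q≢0 ^ℚ (length α ∸ 1))) ⋆ GP q β) (coarsenings α) μ)))
      , (λ q μ → trans (GP-expansion q a r ps μ) (trans
          (∑-cong (coarsenings α) (λ β → cong (((q ^ℚ (length β ∸ 1)) * ((1ℚ - q) ^ℚ (length α ∸ length β))) *_)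
            (sym (hPart-partitionOf β μ))))
          (sym (sumS-map (λ β → ((q ^ℚ (length β ∸ 1)) * ((1ℚ - q) ^ℚ (length α ∸ length β))) ⋆ hPart (partitionOf β)) (coarsenings α) μ))))
      , (λ q μ → trans (GP-partitions q α cα μ)
          (sym (sumS-map (λ lam → ((q ^ℚ (length lam ∸ 1)) * ((1ℚ - q) ^ℚ (length α ∸ length lam))) ⋆ hPart lam) (𝓜 α) μ)))
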